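{- If $(G,Z)$ is a suspect, then $G$ does not admit a proper coherent $W$-join.
   Context: Graphs are finite and simple. Stable set: pairwise non-adjacent; strong: meets every maximal clique. Claw-free: no induced $K_{1,3}$. A path is a sequence of distinct vertices $p_0\hbox{ - }\dots\hbox{ - }p_k$ with $p_i$ adjacent to $p_j$ iff $|i-j|=1$; length $k$. Hole of length $k\ge4$: induced $C_k$; antihole: induced complement of $C_k$. Prism: two vertex-disjoint triangles $\{a_1,a_2,a_3\},\{b_1,b_2,b_3\}$ and paths $P_i$ with ends $a_i,b_i$, for $i<j$ only edges between $V(P_i),V(P_j)$ being $a_ia_j,b_ib_j$; odd if all $P_i$ odd. Handcuff: two vertex-disjoint even holes $C_1,C_2$ and a disjoint odd-length path $p_1\hbox{ - }\dots\hbox{ - }p_r$, $p_1$ with exactly two neighbours in $V(C_1)$, adjacent, $p_r$ with exactly two in $V(C_2)$, adjacent, no other edges among the parts. Eye mask: two vertex-disjoint even holes $C_1,C_2$, edges $x_1y_1\in E(C_1),x_2y_2\in E(C_2)$ with $\{x_1,y_1\}$ complete to $\{x_2,y_2\}$, no other edges between $V(C_1),V(C_2)$. Innocent: no odd hole, no antihole of length $\ge6$, no odd prism, handcuff or eye mask. Simplicial vertex: neighbourhood is a clique. Clown: graph on $\{c_0,\dots,c_k\}$, $c_1\hbox{ - }\dots\hbox{ - }c_k\hbox{ - }c_1$ an even hole, $c_0$ (the hat $h(D)$) adjacent to exactly $c_1,c_2$ among $c_1,\dots,c_k$. A vertex $v$ is safe if simplicial and for every clown $D$ in the graph every path with ends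 $v,h(D)$ whose vertices other than $h(D)$ are disjoint from and anticomplete to $V(D)\setminus\{h(D)\}$ has odd length. Even pair: every path between the two vertices has even length; consistent: every two members form an even pair. A pair $(G,Z)$ is a suspect if $G$ is a claw-free innocent graph, $Z$ is a consistent set of safe vertices of $G$ such that no strong stable set of $G$ contains $Z$, and $|V(G)|$ is minimum among all graphs $G$ for which such a pair exists. A vertex $v\notin X$ is mixed on $X$ if it has both a neighbour and a non-neighbour in $X$. A homogeneous pair in $G$ is a pair $(A,B)$ of disjoint cliques such that every vertex of $V(G)\setminus(A\cup B)$ is either complete or anticomplete to $A$, and either complete or anticomplete to $B$. A $W$-join is a homogeneous pair $(A,B)$ with $A$ neither complete nor anticomplete to $B$. It is coherent if the set of vertices of $V(G)\setminus(A\cup B)$ complete to $A\cup B$ is a clique, and proper if every vertex of $A$ is mixed on $B$ and every vertex of $B$ is mixed on $A$. -}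

module Defs where

open import Data.Nat using (ℕ; zero; suc; _+_; _*_; _≤_)
open import Data.Fin using (Fin; toℕ)
open import Data.Fin.Subset using (Subset; _∈_; _∉_; _⊆_)
open import Data.Bool using (Bool; true; false)
open import Data.Product using (Σ; ∃; ∃-syntax; _×_; _,_)
open import Data.Sum using (_⊎_)
open import Relation.Nullary using (¬_)
open import Relation.Binary.PropositionalEquality using (_≡_; _≢_)
open import Function.Bundles using (_⇔_)
open import Function.Definitions using (Injective)

Even : ℕ → Set
Even m = ∃[ t ] m ≡ 2 * t

Odd : ℕ → Set
Odd m = ∃[ t ] m ≡ suc (2 * t)

record Graph : Set where
  field
    n      : ℕ
    adj    : Fin n → Fin n → Bool
    sym    : ∀ x y → adj x y ≡ adj y x
    irrefl : ∀ x → adj x x ≡ false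

open Graph public

V : Graph → Set
V G = Fin (n G)

E : (G : Graph) → V G → V G → Set
E G x y = adj G x y ≡ true

Consec : ℕ → ℕ → Set
Consec i j = suc i ≡ j ⊎ suc j ≡ i

CycAdj : ℕ → ℕ → ℕ → Set
CycAdj k i j = Consec i j ⊎ ((i ≡ 0 × suc j ≡ k) ⊎ (j ≡ 0 × suc i ≡ k))

IsPath : (G : Graph) (k : ℕ) → (Fin (suc k) → V G) → Set
IsPath G k p = Injective _≡_ _≡_ p
             × (∀ i j → E G (p i) (p j) ⇔ Consec (toℕ i) (toℕ j))

-- a path with ends u and v (oriented from u to v; orientation is immaterial)
PathBetween : (G : Graph) → V G → V G → (k : ℕ) → (Fin (suc k) → V G) → Set
PathBetween G u v k p = IsPath G k p × (∀ i → toℕ i ≡ 0 → p i ≡ u)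
                                      × (∀ i → toℕ i ≡ k → p i ≡ v)

IsHole : (G : Graph) (k : ℕ) → (Fin k → V G) → Set
IsHole G k c = 4 ≤ k × Injective _≡_ _≡_ c
             × (∀ i j → E G (c i) (c j) ⇔ CycAdj k (toℕ i) (toℕ j))

IsEvenHole : (G : Graph) (k : ℕ) → (Fin k → V G) → Set
IsEvenHole G k c = IsHole G k c × Even k

HasOddHole : Graph → Set
HasOddHole G = ∃[ k ] Σ (Fin k → V G) λ c → IsHole G k c × Odd k

IsAntihole : (G : Graph) (k : ℕ) → (Fin k → V G) → Set
IsAntihole G k c = 4 ≤ k × Injective _≡_ _≡_ c
                 × (∀ i j → E G (c i) (c j) ⇔ (i ≢ j × ¬ CycAdj k (toℕ i) (toℕ j)))

HasLongAntihole : Graph → Set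
HasLongAntihole G = ∃[ k ] Σ (Fin k → V G) λ c → IsAntihole G k c × 6 ≤ k

-- Prisms: paths P_0,P_1,P_2 with P_i from a_i to b_i (length k i ≥ 1),
-- pairwise vertex-disjoint, and for i ≠ j the only edges between V(P_i)
-- and V(P_j) are a_i a_j and b_i b_j (so {a_i} and {b_i} are triangles).

IsPrism : (G : Graph) (k : Fin 3 → ℕ) → ((i : Fin 3) → Fin (suc (k i)) → V G) → Set
IsPrism G k p =
    (∀ i → 1 ≤ k i)
  × (∀ i → IsPath G (k i) (p i))
  × (∀ i j → i ≢ j → ∀ x y → p i x ≢ p j y)
  × (∀ i j → i ≢ j → ∀ x y →
       E G (p i x) (p j y) ⇔ ((toℕ x ≡ 0 × toℕ y ≡ 0) ⊎ (toℕ x ≡ k i × toℕ y ≡ k j)))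

HasOddPrism : Graph → Set
HasOddPrism G = Σ (Fin 3 → ℕ) λ k → Σ ((i : Fin 3) → Fin (suc (k i)) → V G) λ p →
                  IsPrism G k p × (∀ i → Odd (k i))

ExactlyTwoAdjacentNbrs : (G : Graph) (k : ℕ) → (Fin k → V G) → V G → Set
ExactlyTwoAdjacentNbrs G k c v =
  ∃[ s ] ∃[ t ] s ≢ t × E G (c s) (c t) × (∀ a → E G v (c a) ⇔ (a ≡ s ⊎ a ≡ t))

HasHandcuff : Graph → Set
HasHandcuff G =
  ∃[ k₁ ] Σ (Fin k₁ → V G) λ c₁ → ∃[ k₂ ] Σ (Fin k₂ → V G) λ c₂ →
  ∃[ m ] Σ (Fin (suc m) → V G) λ q →
      IsEvenHole G k₁ c₁ × IsEvenHole G k₂ c₂ × IsPath G m q × Odd m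
    × (∀ a b → c₁ a ≢ c₂ b) × (∀ a x → c₁ a ≢ q x) × (∀ b x → c₂ b ≢ q x)
    × (∀ a b → ¬ E G (c₁ a) (c₂ b))
    × (∀ x → toℕ x ≡ 0 → ExactlyTwoAdjacentNbrs G k₁ c₁ (q x))
    × (∀ x → toℕ x ≡ m → ExactlyTwoAdjacentNbrs G k₂ c₂ (q x))
    × (∀ x a → toℕ x ≢ 0 → ¬ E G (q x) (c₁ a))
    × (∀ x b → toℕ x ≢ m → ¬ E G (q x) (c₂ b))

HasEyeMask : Graph → Set
HasEyeMask G =
  ∃[ k₁ ] Σ (Fin k₁ → V G) λ c₁ → ∃[ k₂ ] Σ (Fin k₂ → V G) λ c₂ →
      IsEvenHole G k₁ c₁ × IsEvenHole G k₂ c₂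
    × (∀ a b → c₁ a ≢ c₂ b)
    × (∃[ x₁ ] ∃[ y₁ ] ∃[ x₂ ] ∃[ y₂ ]
         E G (c₁ x₁) (c₁ y₁) × E G (c₂ x₂) (c₂ y₂)
       × (∀ a b → E G (c₁ a) (c₂ b) ⇔ ((a ≡ x₁ ⊎ a ≡ y₁) × (b ≡ x₂ ⊎ b ≡ y₂))))

Innocent : Graph → Set
Innocent G = ¬ HasOddHole G × ¬ HasLongAntihole G × ¬ HasOddPrism G
           × ¬ HasHandcuff G × ¬ HasEyeMask G

HasClaw : Graph → Set
HasClaw G = ∃[ c ] ∃[ x ] ∃[ y ] ∃[ z ]
  E G c x × E G c y × E G c z
  × x ≢ y × x ≢ z × y ≢ z
  × ¬ E G x y × ¬ E G x z × ¬ E G y z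

ClawFree : Graph → Set
ClawFree G = ¬ HasClaw G

IsClique : (G : Graph) → Subset (n G) → Set
IsClique G K = ∀ x y → x ∈ K → y ∈ K → x ≢ y → E G x y

IsMaximalClique : (G : Graph) → Subset (n G) → Set
IsMaximalClique G K = IsClique G K × (∀ T → IsClique G T → K ⊆ T → T ⊆ K)

IsStable : (G : Graph) → Subset (n G) → Set
IsStable G S = ∀ x y → x ∈ S → y ∈ S → ¬ E G x y

IsStrongStable : (G : Graph) → Subset (n G) → Set
IsStrongStable G S = IsStable G S
  × (∀ K → IsMaximalClique G K → (∃[ v ] v ∈ K) → ∃[ v ] (v ∈ S × v ∈ K))

IsSimplicial : (G : Graph) → V G → Set
IsSimplicial G v = ∀ x y → E G v x → E G v y → x ≢ y → E G x y

-- clown with hat h and even hole c_1 - ... - c_k - c_1 (here c 0, ..., c (k-1));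
-- the hat is adjacent exactly to the first two hole vertices
IsClown : (G : Graph) → V G → (k : ℕ) → (Fin k → V G) → Set
IsClown G h k c = IsEvenHole G k c × (∀ a → h ≢ c a)
                × (∀ a → E G h (c a) ⇔ (toℕ a ≡ 0 ⊎ toℕ a ≡ 1))

IsSafe : (G : Graph) → V G → Set
IsSafe G v = IsSimplicial G v
  × (∀ h k (c : Fin k → V G) → IsClown G h k c →
       ∀ m (p : Fin (suc m) → V G) → PathBetween G v h m p →
       (∀ x → toℕ x ≢ m → ∀ a → p x ≢ c a × ¬ E G (p x) (c a)) →
       Odd m)

IsEvenPair : (G : Graph) → V G → V G → Set
IsEvenPair G u v = ∀ m (p : Fin (suc m) → V G) → PathBetween G u v m p → Even m

IsConsistent : (G : Graph) → Subset (n G) → Set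
IsConsistent G Z = ∀ u v → u ∈ Z → v ∈ Z → IsEvenPair G u v

IsCandidate : (G : Graph) → Subset (n G) → Set
IsCandidate G Z = ClawFree G × Innocent G × IsConsistent G Z
                × (∀ v → v ∈ Z → IsSafe G v)
                × ¬ (∃[ S ] (IsStrongStable G S × Z ⊆ S))

IsSuspect : (G : Graph) → Subset (n G) → Set
IsSuspect G Z = IsCandidate G Z
              × (∀ (G′ : Graph) (Z′ : Subset (n G′)) → IsCandidate G′ Z′ → n G ≤ n G′)

CompleteTo : (G : Graph) → V G → Subset (n G) → Set
CompleteTo G v A = ∀ a → a ∈ A → E G v a

AnticompleteTo : (G : Graph) → V G → Subset (n G) → Set
AnticompleteTo G v A = ∀ a → a ∈ A → ¬ E G v a

MixedOn : (G : Graph) → V G → Subset (n G) → Set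
MixedOn G v A = (∃[ a ] (a ∈ A × E G v a)) × (∃[ a ] (a ∈ A × ¬ E G v a))

IsHomogeneousPair : (G : Graph) → Subset (n G) → Subset (n G) → Set
IsHomogeneousPair G A B =
    IsClique G A × IsClique G B × (∀ v → v ∈ A → v ∉ B)
  × (∀ v → v ∉ A → v ∉ B →
       (CompleteTo G v A ⊎ AnticompleteTo G v A)
     × (CompleteTo G v B ⊎ AnticompleteTo G v B))

IsWJoin : (G : Graph) → Subset (n G) → Subset (n G) → Set
IsWJoin G A B = IsHomogeneousPair G A B
  × ¬ (∀ a b → a ∈ A → b ∈ B → E G a b)
  × ¬ (∀ a b → a ∈ A → b ∈ B → ¬ E G a b)

IsCoherent : (G : Graph) → Subset (n G) → Subset (n G) → Set
IsCoherent G A B = ∀ x y → x ∉ A → x ∉ B → y ∉ A → y ∉ B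
  → CompleteTo G x A → CompleteTo G x B
  → CompleteTo G y A → CompleteTo G y B
  → x ≢ y → E G x y

IsProper : (G : Graph) → Subset (n G) → Subset (n G) → Set
IsProper G A B = (∀ a → a ∈ A → MixedOn G a B) × (∀ b → b ∈ B → MixedOn G b A)

AdmitsProperCoherentWJoin : Graph → Set
AdmitsProperCoherentWJoin G =
  ∃[ A ] ∃[ B ] (IsWJoin G A B × IsCoherent G A B × IsProper G A B)

{-# OPTIONS --safe #-}
module Submission where

-- Let C and D be the outside vertices complete to A only and to B only, and W the set of outside
-- vertices that are not complete to both. The complement of G[A ∪ B] is a bipartite graph without
-- holes of length ≥ 6, hence has a bisimplicial edge ab (a ∈ A, b ∈ B): every nonadjacent pair
-- a′ ∈ A, b′ ∈ B has b′ ~ a or a′ ~ b. Properness gives a square a₁a₂b₂b₁ across A and B. A shortest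
-- path in W from C to D would close up with the square to an odd prism or an odd hole, so C and D
-- lie in different components of G[W]. Consequently, in H = G[W ∪ {a, b}], the vertices a and b are
-- safe and Z ∪ {a, b} is consistent: every c ∈ C is the hat of a clown on the square, so paths from Z
-- to c are odd, and an even path from a to the hat of a clown would yield a handcuff or an eye mask.
-- By minimality H has a strong stable set containing Z ∪ {a, b}. It is strong in G too, because a
-- maximal clique of G that avoids a and b is contained in W.

open import Defs
open import Data.Nat as ℕ using (ℕ; zero; suc; _+_; _≤_; _<_; z≤n; s≤s)
import Data.Nat.Properties as ℕ
open import Data.Nat.Induction using (Acc; acc; <-wellFounded)
open import Data.Fin as Fin using (Fin; zero; suc; toℕ; inject₁; fromℕ; opposite)
import Data.Fin.Properties as Fin
open import Data.Fin.Induction using (<-weakInduction)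
open import Data.Fin.Subset using (Subset; _∈_; _∉_; _⊆_; _∪_; ⁅_⁆; _-_; ∣_∣; ⊤)
open import Data.Fin.Subset.Properties
  using (_∈?_; ∈⊤; ∣⊤∣≡n; p⊂q⇒∣p∣<∣q∣; p⊆p∪q; x∈p∪q⁺; x∈p∪q⁻; x∈⁅x⁆; x∈⁅y⁆⇒x≡y;
         x∈p∧x≢y⇒x∈p-y; x∈p⇒∣p-x∣<∣p∣)
open import Data.Vec using (_∷_; tabulate; here; there)
open import Data.Vec.Properties using (lookup⇒[]=; []=⇒lookup; lookup∘tabulate)
open import Data.Bool as Bool using (Bool; true; false)
import Data.Bool.Properties as Bool
open import Data.Product using (∃-syntax; _×_; _,_; proj₁; proj₂; swap)
open import Data.Sum as Sum using (_⊎_; inj₁; inj₂; [_,_]′)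
open import Data.Unit using (tt) renaming (⊤ to 𝟙)
open import Data.Empty using (⊥; ⊥-elim)
open import Function using (_∘_)
open import Function.Bundles using (_⇔_; mk⇔; Equivalence)
open import Level using (Level)
open import Relation.Nullary using (¬_; Dec; yes; no; contradiction)
open import Relation.Nullary.Decidable
  using (does; _×-dec_; _⊎-dec_; ¬?; dec-true; dec-false; does-⇔; decidable-stable)
open import Relation.Unary using (Pred; Decidable)
open import Relation.Binary.Definitions using (tri<; tri≈; tri>)
open import Relation.Binary.PropositionalEquality
  using (_≡_; _≢_; refl; trans; cong; subst; subst₂) renaming (sym to ≡-sym)

open Equivalence using (to; from)

-- Induced paths and walks

private variable
  ℓ ℓ₁ : Level

E? : ∀ Γ (x y : V Γ) → Dec (E Γ x y)
E? Γ x y = adj Γ x y Bool.≟ true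

E-sym : ∀ Γ {x y} → E Γ x y → E Γ y x
E-sym Γ {x} {y} = trans (Graph.sym Γ y x)

E-irrefl : ∀ Γ {x} → ¬ E Γ x x
E-irrefl Γ {x} e with () ← trans (≡-sym e) (irrefl Γ x)

E⇒≢ : ∀ Γ {x y} → E Γ x y → x ≢ y
E⇒≢ Γ e refl = E-irrefl Γ e

-- Vertices are indexed by all of `ℕ`, with values beyond `k` ignored, so that cutting off an
-- initial segment and prepending a vertex need no casts between `Fin` types.
InducedPath : (Γ : Graph) → ℕ → (ℕ → V Γ) → Set
InducedPath Γ k p =
    (∀ {i j} → i ≤ k → j ≤ k → p i ≡ p j → i ≡ j)
  × (∀ {i j} → i ≤ k → j ≤ k → E Γ (p i) (p j) ⇔ Consec i j)

inducedPath⇒isPath : ∀ {k} Γ {p} → InducedPath Γ k p → IsPath Γ k (p ∘ toℕ)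
inducedPath⇒isPath Γ (inj , edge) =
    (λ {i} {j} e → Fin.toℕ-injective (inj (Fin.toℕ≤pred[n] i) (Fin.toℕ≤pred[n] j) e))
  , (λ i j → edge (Fin.toℕ≤pred[n] i) (Fin.toℕ≤pred[n] j))

consec-+ : ∀ m {i j} → Consec i j → Consec (m + i) (m + j)
consec-+ m {i} {j} = Sum.map (λ { refl → ≡-sym (ℕ.+-suc m i) }) (λ { refl → ≡-sym (ℕ.+-suc m j) })

consec-cancel : ∀ m {i j} → Consec (m + i) (m + j) → Consec i j
consec-cancel zero c = c
consec-cancel (suc m) c = consec-cancel m (Sum.map ℕ.suc-injective ℕ.suc-injective c)

consec-irrefl : ∀ {i} → ¬ Consec i i
consec-irrefl = [ ℕ.1+n≢n , ℕ.1+n≢n ]′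

dropPath : ∀ {k} Γ {p} m → InducedPath Γ (m + k) p → InducedPath Γ k (λ i → p (m + i))
dropPath Γ m (inj , edge) =
    (λ i≤k j≤k e → ℕ.+-cancelˡ-≡ m _ _ (inj (ℕ.+-monoʳ-≤ m i≤k) (ℕ.+-monoʳ-≤ m j≤k) e))
  , (λ i≤k j≤k → let e = edge (ℕ.+-monoʳ-≤ m i≤k) (ℕ.+-monoʳ-≤ m j≤k) in
       mk⇔ (consec-cancel m ∘ to e) (from e ∘ consec-+ m))

infixr 5 _◂_
_◂_ : {A : Set} → A → (ℕ → A) → ℕ → A
(v ◂ p) zero = v
(v ◂ p) (suc i) = p i

consPath : ∀ {k} Γ {v p} → InducedPath Γ k p → E Γ v (p 0)
  → (∀ {j} → j ≤ k → v ≢ p j) → (∀ {j} → j ≤ k → E Γ v (p j) → j ≡ 0)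
  → InducedPath Γ (suc k) (v ◂ p)
consPath {k} Γ {v} {p} (inj , edge) e₀ new only₀ = inj′ , edge′
  where
  inj′ : ∀ {i j} → i ≤ suc k → j ≤ suc k → (v ◂ p) i ≡ (v ◂ p) j → i ≡ j
  inj′ {zero}  {zero}  _ _ _ = refl
  inj′ {zero}  {suc j} _ (s≤s j≤k) e = contradiction e (new j≤k)
  inj′ {suc i} {zero}  (s≤s i≤k) _ e = contradiction (≡-sym e) (new i≤k)
  inj′ {suc i} {suc j} (s≤s i≤k) (s≤s j≤k) e = cong suc (inj i≤k j≤k e)
  edge′ : ∀ {i j} → i ≤ suc k → j ≤ suc k → E Γ ((v ◂ p) i) ((v ◂ p) j) ⇔ Consec i j
  edge′ {zero}  {zero}  _ _ = mk⇔ (⊥-elim ∘ E-irrefl Γ) (⊥-elim ∘ consec-irrefl)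
  edge′ {zero}  {suc j} _ (s≤s j≤k) =
    mk⇔ (λ e → inj₁ (cong suc (≡-sym (only₀ j≤k e)))) (λ { (inj₁ refl) → e₀ })
  edge′ {suc i} {zero}  (s≤s i≤k) _ =
    mk⇔ (λ e → inj₂ (cong suc (≡-sym (only₀ i≤k (E-sym Γ e))))) (λ { (inj₂ refl) → E-sym Γ e₀ })
  edge′ {suc i} {suc j} (s≤s i≤k) (s≤s j≤k) =
    mk⇔ (consec-+ 1 ∘ to (edge i≤k j≤k)) (from (edge i≤k j≤k) ∘ consec-cancel 1)

-- The bound is returned split as `i + l`, so that the tail after the cut has the form `dropPath`
-- expects.
lastIndex : ∀ {P : Pred ℕ ℓ} → Decidable P → ∀ k {j} → j ≤ k → P j →
  ∃[ i ] ∃[ l ] i + l ≡ k × P i × (∀ {m} → m < l → ¬ P (i + suc m))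
lastIndex P? k j≤k Pj with P? k
lastIndex P? k j≤k Pj | yes Pk = k , 0 , ℕ.+-identityʳ k , Pk , λ ()
lastIndex P? zero z≤n Pj | no ¬Pk = contradiction Pj ¬Pk
lastIndex {P = P} P? (suc k) j≤1+k Pj | no ¬Pk
  with ℕ.m≤n⇒m<n∨m≡n j≤1+k
... | inj₂ refl = contradiction Pj ¬Pk
... | inj₁ (s≤s j≤k) with lastIndex P? k j≤k Pj
...   | i , l , refl , Pi , later = i , suc l , ℕ.+-suc i l , Pi , later′
  where
  later′ : ∀ {m} → m < suc l → ¬ P (i + suc m)
  later′ (s≤s m≤l) Pm with ℕ.m≤n⇒m<n∨m≡n m≤l
  ... | inj₁ m<l = later m<l Pm
  ... | inj₂ refl = ¬Pk (subst P (ℕ.+-suc i l) Pm)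

data Walk (Γ : Graph) (R : Pred (V Γ) ℓ) : V Γ → V Γ → Set ℓ where
  stop : ∀ {v} → R v → Walk Γ R v v
  step : ∀ {u v w} → R u → E Γ u v → Walk Γ R v w → Walk Γ R u w

module _ (Γ : Graph) {R : Pred (V Γ) ℓ} where

  walk-snoc : ∀ {u v w} → Walk Γ R u v → E Γ v w → R w → Walk Γ R u w
  walk-snoc (stop Ru) e Rw = step Ru e (stop Rw)
  walk-snoc (step Ru e₁ p) e Rw = step Ru e₁ (walk-snoc p e Rw)

  walk-start : ∀ {u v} → Walk Γ R u v → R u
  walk-start (stop Ru) = Ru
  walk-start (step Ru _ _) = Ru

  walk-end : ∀ {u v} → Walk Γ R u v → R v
  walk-end (stop Ru) = Ru
  walk-end (step _ _ p) = walk-end p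

  walk-++ : ∀ {u v w} → Walk Γ R u v → Walk Γ R v w → Walk Γ R u w
  walk-++ (stop _) q = q
  walk-++ (step Ru e p) q = step Ru e (walk-++ p q)

  walk-reverse : ∀ {u v} → Walk Γ R u v → Walk Γ R v u
  walk-reverse (stop Ru) = stop Ru
  walk-reverse (step Ru e p) = walk-snoc (walk-reverse p) (E-sym Γ e) Ru

walk-map : ∀ Γ {R : Pred (V Γ) ℓ} {R′ : Pred (V Γ) ℓ₁} → (∀ {v} → R v → R′ v)
  → ∀ {u v} → Walk Γ R u v → Walk Γ R′ u v
walk-map Γ f (stop Ru) = stop (f Ru)
walk-map Γ f (step Ru e p) = step (f Ru) e (walk-map Γ f p)

record PathTo (Γ : Graph) {ℓ₁ ℓ} (Q : Pred (V Γ) ℓ₁) (R : Pred (V Γ) ℓ) (v : V Γ) : Set (ℓ₁ Level.⊔ ℓ) where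
  field
    len     : ℕ
    vtx     : ℕ → V Γ
    induced : InducedPath Γ len vtx
    start   : vtx 0 ≡ v
    end     : Q (vtx len)
    inside  : ∀ {i} → i ≤ len → R (vtx i)
    early   : ∀ {i} → i < len → ¬ Q (vtx i)

-- Induction along the walk: a new vertex `u` is attached at its last contact with the path built so
-- far, so no chord to a later vertex survives. Stopping at the first vertex in `Q` gives `early`.
walk⇒path : ∀ Γ {Q : Pred (V Γ) ℓ₁} {R : Pred (V Γ) ℓ} → Decidable Q
  → ∀ {u w} → Walk Γ R u w → Q w → PathTo Γ Q R u
walk⇒path Γ {Q = Q} {R} Q? = go
  where
  trivial : ∀ {v} → Q v → R v → PathTo Γ Q R v
  trivial {v} Qv Rv = record
    { len = 0 ; vtx = λ _ → v ; start = refl ; end = Qv ; inside = λ _ → Rv ; early = λ ()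
    ; induced = (λ { z≤n z≤n _ → refl })
              , (λ { z≤n z≤n → mk⇔ (⊥-elim ∘ E-irrefl Γ) (⊥-elim ∘ consec-irrefl) }) }
  extend : ∀ {u v} → ¬ Q u → R u → E Γ u v → PathTo Γ Q R v → PathTo Γ Q R u
  extend {u} ¬Qu Ru e P
    with P .PathTo.len | P .PathTo.vtx | P .PathTo.start
       | P .PathTo.induced | P .PathTo.end | P .PathTo.inside | P .PathTo.early
  ... | n | p | refl | ind | Qe | ins | ear
    -- Equality counts as contact because the walk may revisit `u`; the remaining path then already
    -- starts at `u`.
    with lastIndex (λ i → (u Fin.≟ p i) ⊎-dec E? Γ u (p i)) n z≤n (inj₂ e)
  ... | i , l , refl , found , later = attach found
    where
    ear′ : ∀ {j} → j < l → ¬ Q (p (i + j))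
    ear′ j<l = ear (ℕ.+-monoʳ-< i j<l)
    ins′ : ∀ {j} → j ≤ l → R (p (i + j))
    ins′ j≤l = ins (ℕ.+-monoʳ-≤ i j≤l)
    attach : u ≡ p i ⊎ E Γ u (p i) → PathTo Γ Q R u
    attach (inj₁ refl) = record
      { len = l ; vtx = λ j → p (i + j) ; induced = dropPath Γ i ind
      ; start = cong p (ℕ.+-identityʳ i) ; end = Qe ; inside = ins′ ; early = ear′ }
    attach (inj₂ e) = record
      { len = suc l ; vtx = u ◂ (λ j → p (i + j)) ; start = refl ; end = Qe
      ; induced = consPath Γ (dropPath Γ i ind) e₀ new only₀
      ; inside = λ { {zero} _ → Ru ; {suc j} (s≤s j≤l) → ins′ j≤l }
      ; early = λ { {zero} _ → ¬Qu ; {suc j} (s≤s j<l) → ear′ j<l } }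
      where
      e₀ : E Γ u (p (i + 0))
      e₀ = subst (λ j → E Γ u (p j)) (≡-sym (ℕ.+-identityʳ i)) e
      new : ∀ {j} → j ≤ l → u ≢ p (i + j)
      new {zero} _ eq = E-irrefl Γ (subst (E Γ u) (≡-sym eq) e₀)
      new {suc j} j<l eq = later j<l (inj₁ eq)
      only₀ : ∀ {j} → j ≤ l → E Γ u (p (i + j)) → j ≡ 0
      only₀ {zero} _ _ = refl
      only₀ {suc j} j<l e = ⊥-elim (later j<l (inj₂ e))
  go : ∀ {u w} → Walk Γ R u w → Q w → PathTo Γ Q R u
  go (stop Ru) Qw = trivial Qw Ru
  go {u} (step Ru e walk) Qw with Q? u
  ... | yes Qu = trivial Qu Ru
  ... | no ¬Qu = extend ¬Qu Ru e (go walk Qw)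

record Link (Γ : Graph) {ℓ₂ ℓ₁ ℓ} (P : Pred (V Γ) ℓ₂) (Q : Pred (V Γ) ℓ₁) (R : Pred (V Γ) ℓ)
  : Set (ℓ₂ Level.⊔ ℓ₁ Level.⊔ ℓ) where
  field
    len     : ℕ
    vtx     : ℕ → V Γ
    induced : InducedPath Γ len vtx
    start   : P (vtx 0)
    end     : Q (vtx len)
    inside  : ∀ {i} → i ≤ len → R (vtx i)
    late    : ∀ {i} → i < len → ¬ P (vtx (suc i))
    early   : ∀ {i} → i < len → ¬ Q (vtx i)

-- The walk is first cut at `Q`, then at the last vertex in `P`; the second cut leaves the far end
-- untouched, so `early` survives it.
walk⇒link : ∀ Γ {ℓ₂} {P : Pred (V Γ) ℓ₂} {Q : Pred (V Γ) ℓ₁} {R : Pred (V Γ) ℓ} → Decidable P → Decidable Q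
  → ∀ {u w} → Walk Γ R u w → P u → Q w → Link Γ P Q R
walk⇒link Γ {P = P} P? Q? {u} walk Pu Qw
  with record { len = n ; vtx = p ; start = refl ; induced = ind ; end = e ; inside = ins ; early = ear }
         ← walk⇒path Γ Q? walk Qw
  with i , l , refl , found , later ← lastIndex (P? ∘ p) n z≤n Pu
  = record
    { len = l ; vtx = λ j → p (i + j) ; induced = dropPath Γ i ind
    ; start = subst (P ∘ p) (≡-sym (ℕ.+-identityʳ i)) found ; end = e
    ; inside = ins ∘ ℕ.+-monoʳ-≤ i ; late = later ; early = ear ∘ ℕ.+-monoʳ-< i }

-- The cycle runs `x`, `y`, `p 0`, ..., `p k` and back to `x`. Its length `3 + k` has the opposite
-- parity to `k`, and `1 ≤ k` makes it at least 4.
closePath : ∀ {k} Γ {p x y} → InducedPath Γ k p → 1 ≤ k → E Γ x y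
  → (∀ {i} → i ≤ k → x ≢ p i × (E Γ x (p i) ⇔ i ≡ k))
  → (∀ {i} → i ≤ k → y ≢ p i × (E Γ y (p i) ⇔ i ≡ 0))
  → IsHole Γ (3 + k) ((x ◂ y ◂ p) ∘ toℕ)
closePath {k} Γ {p} {x} {y} (inj , edge) 1≤k xy atx aty =
  s≤s (s≤s (s≤s 1≤k))
  , (λ {i} {j} e → Fin.toℕ-injective (inj′ (toℕ i) (toℕ j) (Fin.toℕ≤pred[n] i) (Fin.toℕ≤pred[n] j) e))
  , (λ i j → edge′ (toℕ i) (toℕ j) (Fin.toℕ≤pred[n] i) (Fin.toℕ≤pred[n] j))
  where
  c : ℕ → V Γ
  c = x ◂ y ◂ p
  inj′ : ∀ i j → i ≤ 2 + k → j ≤ 2 + k → c i ≡ c j → i ≡ j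
  inj′ 0 0 _ _ _ = refl
  inj′ 0 1 _ _ e = contradiction e (E⇒≢ Γ xy)
  inj′ 0 (suc (suc j)) _ (s≤s (s≤s j≤k)) e = contradiction e (proj₁ (atx j≤k))
  inj′ 1 0 _ _ e = contradiction (≡-sym e) (E⇒≢ Γ xy)
  inj′ 1 1 _ _ _ = refl
  inj′ 1 (suc (suc j)) _ (s≤s (s≤s j≤k)) e = contradiction e (proj₁ (aty j≤k))
  inj′ (suc (suc i)) 0 (s≤s (s≤s i≤k)) _ e = contradiction (≡-sym e) (proj₁ (atx i≤k))
  inj′ (suc (suc i)) 1 (s≤s (s≤s i≤k)) _ e = contradiction (≡-sym e) (proj₁ (aty i≤k))
  inj′ (suc (suc i)) (suc (suc j)) (s≤s (s≤s i≤k)) (s≤s (s≤s j≤k)) e =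
    cong (2 +_) (inj i≤k j≤k e)
  CA : ℕ → ℕ → Set
  CA = CycAdj (3 + k)
  CA-sym : ∀ {i j} → CA i j → CA j i
  CA-sym = Sum.map Sum.swap Sum.swap
  swapped : ∀ {i j} → E Γ (c i) (c j) ⇔ CA i j → E Γ (c j) (c i) ⇔ CA j i
  swapped {i} {j} e = mk⇔ (CA-sym ∘ to e ∘ E-sym Γ) (E-sym Γ ∘ from e ∘ CA-sym)
  x-edge : ∀ {j} → j ≤ k → E Γ x (p j) ⇔ CA 0 (2 + j)
  x-edge j≤k = mk⇔ (λ e → inj₂ (inj₁ (refl , cong (3 +_) (to (proj₂ (atx j≤k)) e))))
    (λ { (inj₂ (inj₁ (_ , refl))) → from (proj₂ (atx j≤k)) refl
       ; (inj₂ (inj₂ (() , _))) ; (inj₁ (inj₁ ())) ; (inj₁ (inj₂ ())) })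
  y-edge : ∀ {j} → j ≤ k → E Γ y (p j) ⇔ CA 1 (2 + j)
  y-edge j≤k = mk⇔ (λ e → inj₁ (inj₁ (cong (2 +_) (≡-sym (to (proj₂ (aty j≤k)) e)))))
    (λ { (inj₁ (inj₁ refl)) → from (proj₂ (aty j≤k)) refl ; (inj₁ (inj₂ ()))
       ; (inj₂ (inj₁ (() , _))) ; (inj₂ (inj₂ (() , _))) })
  edge′ : ∀ i j → i ≤ 2 + k → j ≤ 2 + k → E Γ (c i) (c j) ⇔ CA i j
  edge′ 0 0 _ _ = mk⇔ (⊥-elim ∘ E-irrefl Γ)
    (λ { (inj₁ c) → ⊥-elim (consec-irrefl c) ; (inj₂ (inj₁ ())) ; (inj₂ (inj₂ ())) })
  edge′ 0 1 _ _ = mk⇔ (λ _ → inj₁ (inj₁ refl)) (λ _ → xy)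
  edge′ 0 (suc (suc j)) _ (s≤s (s≤s j≤k)) = x-edge j≤k
  edge′ 1 0 _ _ = mk⇔ (λ _ → inj₁ (inj₂ refl)) (λ _ → E-sym Γ xy)
  edge′ 1 1 _ _ = mk⇔ (⊥-elim ∘ E-irrefl Γ)
    (λ { (inj₁ c) → ⊥-elim (consec-irrefl c) ; (inj₂ (inj₁ ())) ; (inj₂ (inj₂ ())) })
  edge′ 1 (suc (suc j)) _ (s≤s (s≤s j≤k)) = y-edge j≤k
  edge′ (suc (suc i)) 0 (s≤s (s≤s i≤k)) _ = swapped {0} {2 + i} (x-edge i≤k)
  edge′ (suc (suc i)) 1 (s≤s (s≤s i≤k)) _ = swapped {1} {2 + i} (y-edge i≤k)
  edge′ (suc (suc i)) (suc (suc j)) (s≤s (s≤s i≤k)) (s≤s (s≤s j≤k)) =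
    mk⇔ (inj₁ ∘ consec-+ 2 ∘ to (edge i≤k j≤k))
        (λ { (inj₁ c) → from (edge i≤k j≤k) (consec-cancel 2 c)
           ; (inj₂ (inj₁ (() , _))) ; (inj₂ (inj₂ (() , _))) })

edgePath : ∀ Γ {x y} → E Γ x y → InducedPath Γ 1 (x ◂ λ _ → y)
edgePath Γ {x} {y} e = consPath Γ
  ((λ { z≤n z≤n _ → refl }) , (λ { z≤n z≤n → mk⇔ (⊥-elim ∘ E-irrefl Γ) (⊥-elim ∘ consec-irrefl) }))
  e (λ _ → E⇒≢ Γ e) (λ { z≤n _ → refl })

-- Bisimplicial edges of chordal bipartite graphs

walk-closed : ∀ Γ {ℓ ℓ₁} {R : Pred (V Γ) ℓ} {T : Pred (V Γ) ℓ₁}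
  → (∀ {v w} → T v → E Γ v w → R w → T w) → ∀ {v w} → T v → Walk Γ R v w → T w
walk-closed Γ grow Tv (stop _) = Tv
walk-closed Γ grow Tv (step _ e p) = walk-closed Γ grow (grow Tv e (walk-start Γ p)) p

≢-≢⇒≡ : ∀ {a b c} → a ≢ b → b ≢ c → a ≡ c
≢-≢⇒≡ a≢b b≢c = trans (Bool.¬-not a≢b) (≡-sym (Bool.¬-not (b≢c ∘ ≡-sym)))

IsBisimplicial : (Γ : Graph) → V Γ → V Γ → Set
IsBisimplicial Γ x y = ∀ {u w} → E Γ y u → E Γ x w → E Γ u w

-- The colouring rules out odd holes and `noLongHole` those of length at least 6, so every hole is a
-- square.
module ChordalBipartite (Γ : Graph) (col : V Γ → Bool)
  (bip : ∀ {u v} → E Γ u v → col u ≢ col v)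
  (noLongHole : ∀ {k} (c : Fin k → V Γ) → IsHole Γ k c → ¬ 6 ≤ k)
  where

  Adj : V Γ → V Γ → Set
  Adj = E Γ

  Adj-sym : ∀ {u v} → Adj u v → Adj v u
  Adj-sym = E-sym Γ

  bip² : ∀ {u v w} → Adj u v → Adj v w → col u ≡ col w
  bip² uv vw = ≢-≢⇒≡ (bip uv) (bip vw)

  -- For an edge `xy` this also excludes `x` and `y` themselves, as they are adjacent to each other.
  Avoid : V Γ → V Γ → V Γ → Set
  Avoid x y v = ¬ Adj x v × ¬ Adj y v

  -- An induced 2K₂; distinctness of the four vertices follows from the adjacencies.
  Independent : V Γ → V Γ → V Γ → V Γ → Set
  Independent x y z t = Adj x y × Adj z t × Avoid x y z × Avoid x y t

  -- Vertices of equal colour are never adjacent, so only two of the four cross pairs have to be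
  -- checked.
  independent : ∀ {v v′ w w′} → Adj v v′ → Adj w w′ → ¬ Adj v w′ → ¬ Adj w v′ → col v ≡ col w
    → Independent v v′ w w′
  independent {w′ = w′} vv′ ww′ ¬vw′ ¬wv′ v≡w =
    vv′ , ww′ , ((λ e → bip e v≡w) , ¬wv′ ∘ Adj-sym)
    , (¬vw′ , λ e → bip e (≢-≢⇒≡ (bip (Adj-sym vv′)) (subst (_≢ col w′) (≡-sym v≡w) (bip ww′))))

  3≤len : ∀ {k p} → InducedPath Γ k p → col (p 0) ≢ col (p k) → ¬ Adj (p 0) (p k) → 3 ≤ k
  3≤len {0} ind c≢ _ = contradiction refl c≢
  3≤len {1} ind _ ¬e = contradiction (from (proj₂ ind z≤n (s≤s z≤n)) (inj₁ refl)) ¬e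
  3≤len {2} ind c≢ _ = contradiction (bip² (from (proj₂ ind z≤n (s≤s z≤n)) (inj₁ refl))
    (from (proj₂ ind (s≤s z≤n) (s≤s (s≤s z≤n))) (inj₁ refl))) c≢
  3≤len {suc (suc (suc _))} _ _ _ = s≤s (s≤s (s≤s z≤n))

  -- Otherwise an induced path from `u` to `w` through vertices avoiding `x` and `y` closes up with
  -- the edge `xy`. Its ends are nonadjacent and of different colours, so it has length at least 3
  -- and the hole has length at least 6.
  biclique : ∀ {x y u w v v′} → Adj x y → Adj y u → Adj x w
    → Adj v u → Walk Γ (Avoid x y) v v′ → Adj v′ w → Adj u w
  biclique {x} {y} {u} {w} {v} {v′} xy yu xw vu walk v′w = decidable-stable (E? Γ u w) absurd
    where
    R : V Γ → Set
    R a = Avoid x y a ⊎ (a ≡ u ⊎ a ≡ w)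
    whole : Walk Γ R u w
    whole = step (inj₂ (inj₁ refl)) (Adj-sym vu)
              (walk-snoc Γ (walk-map Γ inj₁ walk) v′w (inj₂ (inj₂ refl)))
    ¬xu : ¬ Adj x u
    ¬xu xu = bip xu (bip² xy yu)
    ¬yw : ¬ Adj y w
    ¬yw yw = bip yw (bip² (Adj-sym xy) xw)
    x≢u : x ≢ u
    x≢u refl = proj₁ (walk-start Γ walk) (Adj-sym vu)
    y≢w : y ≢ w
    y≢w refl = proj₂ (walk-end Γ walk) (Adj-sym v′w)
    absurd : ¬ ¬ Adj u w
    absurd ¬uw with walk⇒link Γ (Fin._≟ u) (Fin._≟ w) whole refl refl
    ... | record { len = k ; vtx = p ; induced = ind ; start = refl ; end = refl ; inside = ins } =
      noLongHole _ (closePath Γ ind (ℕ.≤-trans (s≤s z≤n) 3≤k) xy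
          (λ i≤k → at-x i≤k (ins i≤k)) (λ i≤k → at-y i≤k (ins i≤k)))
        (s≤s (s≤s (s≤s 3≤k)))
      where
      3≤k : 3 ≤ k
      3≤k = 3≤len ind (λ e → bip xw (trans (bip² xy yu) e)) ¬uw
      at-x : ∀ {i} → i ≤ k → R (p i) → x ≢ p i × (Adj x (p i) ⇔ i ≡ k)
      at-x i≤k (inj₁ (¬xi , ¬yi)) =
        (λ { refl → ¬yi (Adj-sym xy) }) , mk⇔ (⊥-elim ∘ ¬xi) (λ { refl → xw })
      at-x i≤k (inj₂ (inj₁ i=u)) = subst (x ≢_) (≡-sym i=u) x≢u
        , mk⇔ (λ e → contradiction (subst (Adj x) i=u e) ¬xu) (λ { refl → xw })
      at-x i≤k (inj₂ (inj₂ i=w)) = subst (x ≢_) (≡-sym i=w) (E⇒≢ Γ xw)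
        , mk⇔ (λ _ → proj₁ ind i≤k ℕ.≤-refl i=w) (λ { refl → xw })
      at-y : ∀ {i} → i ≤ k → R (p i) → y ≢ p i × (Adj y (p i) ⇔ i ≡ 0)
      at-y i≤k (inj₁ (¬xi , ¬yi)) =
        (λ { refl → ¬xi xy }) , mk⇔ (⊥-elim ∘ ¬yi) (λ { refl → yu })
      at-y i≤k (inj₂ (inj₁ i=u)) = subst (y ≢_) (≡-sym i=u) (E⇒≢ Γ yu)
        , mk⇔ (λ _ → proj₁ ind i≤k z≤n i=u) (λ { refl → yu })
      at-y i≤k (inj₂ (inj₂ i=w)) = subst (y ≢_) (≡-sym i=w) y≢w
        , mk⇔ (λ e → contradiction (subst (Adj y) i=w e) ¬yw) (λ { refl → yu })

  -- Without two independent edges the neighbourhoods on one side form a chain, and an edge at a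
  -- vertex with minimal neighbourhood is bisimplicial.
  chain⇒bisimplicial : ∀ {ℓ} {T : Pred (V Γ) ℓ}
    → (∀ {x y} → Adj x y → ¬ IsBisimplicial Γ x y)
    → (∀ {v v′ u w} → T v → T v′ → Adj v v′ → Adj v′ u → Adj v w → ¬ Adj u w → T u × T w)
    → (∀ {v v′ w w′} → T v → T v′ → T w → T w′ → ¬ Independent v v′ w w′)
    → ∀ {v v′} → T v → T v′ → ¬ Adj v v′
  chain⇒bisimplicial {T = T} noBis escape no2K₂ {v} Tv Tv′ vv′ =
    descend ⊤ (<-wellFounded _) Tv Tv′ vv′ (λ _ → ∈⊤)
    where
    descend : ∀ r → Acc _<_ ∣ r ∣ → ∀ {v v′} → T v → T v′ → Adj v v′ → ¬ (∀ {w} → Adj v w → w ∈ r)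
    descend r (acc rs) {v} {v′} Tv Tv′ vv′ N⊆r =
      noBis vv′ λ {u} {w} v′u vw → decidable-stable (E? Γ u w) λ ¬uw →
        let Tu , Tw = escape Tv Tv′ vv′ v′u vw ¬uw
            -- A neighbour `t` of `u` missed by `v` would make `ut` and `vw` independent. So the
            -- neighbourhood of `u` lies in that of `v`, strictly because of `w`.
            N⊆N : ∀ {t} → Adj u t → Adj v t
            N⊆N ut = decidable-stable (E? Γ v _) λ ¬vt →
              let _ , Tt = escape Tu Tv′ (Adj-sym v′u) (Adj-sym vv′) ut ¬vt in
              no2K₂ Tu Tt Tv Tw (independent ut vw ¬uw ¬vt (bip² (Adj-sym v′u) (Adj-sym vv′)))
        in descend (r - w) (rs (x∈p⇒∣p-x∣<∣p∣ (N⊆r vw))) Tu Tv′ (Adj-sym v′u)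
             (λ ut → x∈p∧x≢y⇒x∈p-y (N⊆r (N⊆N ut)) λ { refl → ¬uw ut })

  -- T below is the component of z once the neighbourhoods of x and y are deleted. Its attachments
  -- form a biclique complete to T (else some other pair gives a smaller component), so T can be
  -- treated as if it were the whole graph.
  noIndependent : (∀ {x y} → Adj x y → ¬ IsBisimplicial Γ x y)
    → ∀ s → Acc _<_ ∣ s ∣ → ∀ {x y z t} → Independent x y z t
    → ¬ (∀ {v} → Walk Γ (Avoid x y) z v → v ∈ s)
  noIndependent noBis s (acc rs) {x} {y} {z} {t} (xy , zt , avz , avt) T⊆s =
    chain⇒bisimplicial noBis escape no2K₂ Tz Tt zt
    where
    T : V Γ → Set
    T = Walk Γ (Avoid x y) z
    Tz : T z
    Tz = stop avz
    Tt : T t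
    Tt = step avz zt (stop avt)
    comp : ∀ {u w v v′} → Adj y u → Adj x w → T v → Adj v u → T v′ → Adj v′ w → Adj u w
    comp yu xw Tv vu Tv′ v′w = biclique xy yu xw vu (walk-++ Γ (walk-reverse Γ Tv) Tv′) v′w
    -- The recursive call: `stay` keeps the component left by `v₀v₁` inside `T`, and `v` drops out
    -- of it because it is adjacent to `v₀` or `v₁`.
    smaller : ∀ {v v₀ v₁ w w′} → T v → T w → Adj v v₀ ⊎ Adj v v₁ → Independent v₀ v₁ w w′
      → (∀ {a b} → T a → Adj a b → Avoid v₀ v₁ b → ¬ Adj x b × ¬ Adj y b) → ⊥
    smaller {v} Tv Tw v~ ind stay = noIndependent noBis (s - v) (rs (x∈p⇒∣p-x∣<∣p∣ (T⊆s Tv))) ind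
      λ walk → x∈p∧x≢y⇒x∈p-y
        (T⊆s (walk-closed Γ (λ Ta ab R → walk-snoc Γ Ta ab (stay Ta ab R)) Tw walk))
        λ { refl → [ (λ e → proj₁ (walk-end Γ walk) (Adj-sym e))
                   , (λ e → proj₂ (walk-end Γ walk) (Adj-sym e)) ]′ v~ }
    avoid : ∀ {v} → T v → Avoid x y v
    avoid = walk-end Γ
    -- If `w` missed `a`, then `xw` and `aa′` would be independent. The component left by `xw` loses
    -- `v` and stays in `T`, since an attachment of `T` adjacent to `y` is adjacent to `w` by
    -- `comp`.
    full-x : ∀ {w v a a′} → Adj x w → T v → Adj v w → T a → T a′ → Adj a a′ → col a ≡ col v → Adj w a
    full-x {w} {v} {a} xw Tv vw Ta Ta′ aa′ a≡v = decidable-stable (E? Γ w a) λ ¬wa →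
      smaller Tv Ta (inj₂ vw)
        (independent xw aa′ (proj₁ (avoid Ta′)) (¬wa ∘ Adj-sym)
          (trans (bip² xw (Adj-sym vw)) (≡-sym a≡v)))
        λ Tc cd (¬xd , ¬wd) → ¬xd , λ yd → ¬wd (Adj-sym (comp yd xw Tc cd Tv vw))
    full-y : ∀ {w v a a′} → Adj y w → T v → Adj v w → T a → T a′ → Adj a a′ → col a ≡ col v → Adj w a
    full-y {w} {v} {a} yw Tv vw Ta Ta′ aa′ a≡v = decidable-stable (E? Γ w a) λ ¬wa →
      smaller Tv Ta (inj₂ vw)
        (independent yw aa′ (proj₂ (avoid Ta′)) (¬wa ∘ Adj-sym)
          (trans (bip² yw (Adj-sym vw)) (≡-sym a≡v)))
        λ Tc cd (¬yd , ¬wd) → (λ xd → ¬wd (comp yw xd Tv vw Tc cd)) , ¬yd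
    place : ∀ {v w} → T v → Adj v w → T w ⊎ (Adj x w ⊎ Adj y w)
    place {v} {w} Tv vw with E? Γ x w | E? Γ y w
    ... | yes xw | _ = inj₂ (inj₁ xw)
    ... | no _ | yes yw = inj₂ (inj₂ yw)
    ... | no ¬xw | no ¬yw = inj₁ (walk-snoc Γ Tv vw (¬xw , ¬yw))
    full : ∀ {w v a a′} → Adj x w ⊎ Adj y w → T v → Adj v w → T a → T a′ → Adj a a′ → col a ≡ col v
      → Adj w a
    full (inj₁ xw) = full-x xw
    full (inj₂ yw) = full-y yw
    -- Attachments at different ends of `xy` are adjacent by `comp`, an attachment and a vertex of
    -- `T` by `full`. Two attachments at the same end would have equal colours, but `u` and `w` do
    -- not.
    escape : ∀ {v v′ u w} → T v → T v′ → Adj v v′ → Adj v′ u → Adj v w → ¬ Adj u w → T u × T w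
    escape {v} {v′} {u} {w} Tv Tv′ vv′ v′u vw ¬uw with place Tv′ v′u | place Tv vw
    ... | inj₁ Tu | inj₁ Tw = Tu , Tw
    ... | inj₂ ~u | inj₁ Tw = contradiction
      (full ~u Tv′ v′u Tw Tv (Adj-sym vw) (bip² (Adj-sym vw) vv′)) ¬uw
    ... | inj₁ Tu | inj₂ ~w = contradiction
      (Adj-sym (full ~w Tv vw Tu Tv′ (Adj-sym v′u) (bip² (Adj-sym v′u) (Adj-sym vv′)))) ¬uw
    ... | inj₂ (inj₁ xu) | inj₂ (inj₂ yw) = contradiction (Adj-sym (comp yw xu Tv vw Tv′ v′u)) ¬uw
    ... | inj₂ (inj₂ yu) | inj₂ (inj₁ xw) = contradiction (comp yu xw Tv′ v′u Tv vw) ¬uw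
    ... | inj₂ (inj₁ xu) | inj₂ (inj₁ xw) = contradiction (bip² (Adj-sym xu) xw) u≢w
      where
      u≢w : col u ≢ col w
      u≢w = subst (_≢ col w) (bip² vv′ v′u) (bip vw)
    ... | inj₂ (inj₂ yu) | inj₂ (inj₂ yw) = contradiction (bip² (Adj-sym yu) yw) u≢w
      where
      u≢w : col u ≢ col w
      u≢w = subst (_≢ col w) (bip² vv′ v′u) (bip vw)
    -- Each attachment is complete to one colour class of `T`, so it is adjacent to `v` or `v′`.
    -- Hence the component left by `vv′` stays in `T`.
    no2K₂ : ∀ {v v′ w w′} → T v → T v′ → T w → T w′ → ¬ Independent v v′ w w′
    no2K₂ {v} {v′} Tv Tv′ Tw Tw′ ind@(vv′ , _) = smaller Tv Tw (inj₂ vv′) ind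
      λ Tc cd av → (λ xd → blocked (inj₁ xd) Tc cd av) , (λ yd → blocked (inj₂ yd) Tc cd av)
      where
      blocked : ∀ {c d} → Adj x d ⊎ Adj y d → T c → Adj c d → ¬ Avoid v v′ d
      blocked {c} ~d Tc cd (¬vd , ¬v′d) with col v Bool.≟ col c
      ... | yes v≡c = ¬vd (Adj-sym (full ~d Tc cd Tv Tv′ vv′ v≡c))
      ... | no v≢c = ¬v′d (Adj-sym (full ~d Tc cd Tv′ Tv (Adj-sym vv′)
                              (≢-≢⇒≡ (bip (Adj-sym vv′)) v≢c)))

  -- Existence is left doubly negated, which suffices for deriving a contradiction. The chain
  -- argument runs with the whole graph as `T`.
  bisimplicialEdge : ∀ {x y} → Adj x y → ¬ (∀ {x y} → Adj x y → ¬ IsBisimplicial Γ x y)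
  bisimplicialEdge xy noBis = chain⇒bisimplicial {T = λ _ → 𝟙} noBis (λ _ _ _ _ _ _ → tt , tt)
    (λ _ _ _ _ ind → noIndependent noBis ⊤ (<-wellFounded _) ind (λ _ → ∈⊤)) tt tt xy

-- Parity, reversed paths and prisms

parity : ∀ m → Even m ⊎ Odd m
parity zero = inj₁ (0 , refl)
parity (suc m) with parity m
... | inj₁ (t , refl) = inj₂ (t , refl)
... | inj₂ (t , refl) = inj₁ (suc t , cong suc (≡-sym (ℕ.+-suc t (t + 0))))

even⇒odd-suc : ∀ {m} → Even m → Odd (suc m)
even⇒odd-suc (t , e) = t , cong suc e

odd⇒even-suc : ∀ {m} → Odd m → Even (suc m)
odd⇒even-suc (t , refl) = suc t , cong suc (≡-sym (ℕ.+-suc t (t + 0)))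

even-suc⇒odd : ∀ {m} → Even (suc m) → Odd m
even-suc⇒odd (suc t , eq) = t , ℕ.suc-injective (trans eq (cong suc (ℕ.+-suc t (t + 0))))

-- Clowns single out two hole vertices by their numerical position, handcuffs and eye masks by
-- index.
firstTwo : ∀ {n} {i : Fin (2 + n)} → (toℕ i ≡ 0 ⊎ toℕ i ≡ 1) ⇔ (i ≡ zero ⊎ i ≡ suc zero)
firstTwo = mk⇔ (Sum.map (λ e → Fin.toℕ-injective e) (λ e → Fin.toℕ-injective e))
               (Sum.map (λ { refl → refl }) (λ { refl → refl }))

module _ (Γ : Graph) where

  tailPath : ∀ {m p} → IsPath Γ (suc m) p → IsPath Γ m (p ∘ suc)
  tailPath (inj , edge) = (λ e → Fin.suc-injective (inj e)) , λ i j →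
    mk⇔ (consec-cancel 1 ∘ to (edge (suc i) (suc j))) (from (edge (suc i) (suc j)) ∘ consec-+ 1)

  reversePath : ∀ {m p} → IsPath Γ m p → IsPath Γ m (p ∘ opposite)
  reversePath {m} (inj , edge) =
      (λ {i} {j} e → trans (≡-sym (Fin.opposite-involutive i))
                       (trans (cong opposite (inj e)) (Fin.opposite-involutive j)))
    , λ i j → mk⇔
        (λ e → subst₂ (λ i j → Consec (toℕ i) (toℕ j)) (Fin.opposite-involutive i) (Fin.opposite-involutive j)
                 (flipped _ _ (to (edge (opposite i) (opposite j)) e)))
        (from (edge (opposite i) (opposite j)) ∘ flipped i j)
    where
    mirror : ∀ i → toℕ i + toℕ (opposite i) ≡ m
    mirror i = trans (cong (toℕ i +_) (Fin.opposite-prop i)) (ℕ.m+[n∸m]≡n (Fin.toℕ≤pred[n] i))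
    shifted : ∀ {a b c d} → a + b ≡ m → c + d ≡ m → suc a ≡ c → suc d ≡ b
    shifted {a} {d = d} ab cd refl =
      ℕ.+-cancelˡ-≡ a _ _ (trans (ℕ.+-suc a d) (trans cd (≡-sym ab)))
    flipped : ∀ i j → Consec (toℕ i) (toℕ j) → Consec (toℕ (opposite i)) (toℕ (opposite j))
    flipped i j (inj₁ e) = inj₂ (shifted (mirror i) (mirror j) e)
    flipped i j (inj₂ e) = inj₁ (shifted (mirror j) (mirror i) e)

  reverseBetween : ∀ {u v m p} → PathBetween Γ u v m p → PathBetween Γ v u m (p ∘ opposite)
  reverseBetween {m = m} (path , p₀ , pₘ) = reversePath path
    , (λ i e → pₘ (opposite i) (trans (Fin.opposite-prop i) (cong (m ℕ.∸_) e)))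
    , (λ i e → p₀ (opposite i) (trans (Fin.opposite-prop i) (trans (cong (m ℕ.∸_) e) (ℕ.n∸n≡0 m))))

  prism : (k : Fin 3 → ℕ) (q : Fin 3 → ℕ → V Γ) → (∀ i → 1 ≤ k i) → (∀ i → InducedPath Γ (k i) (q i))
    → (∀ {i j} → i Fin.< j → ∀ {x y} → x ≤ k i → y ≤ k j →
         q i x ≢ q j y × (E Γ (q i x) (q j y) ⇔ ((x ≡ 0 × y ≡ 0) ⊎ (x ≡ k i × y ≡ k j))))
    → IsPrism Γ k (λ i → q i ∘ toℕ)
  prism k q pos path cross =
      pos , (λ i → inducedPath⇒isPath Γ (path i))
    , (λ i j i≢j x y → proj₁ (cross′ i≢j (Fin.toℕ≤pred[n] x) (Fin.toℕ≤pred[n] y)))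
    , (λ i j i≢j x y → proj₂ (cross′ i≢j (Fin.toℕ≤pred[n] x) (Fin.toℕ≤pred[n] y)))
    where
    cross′ : ∀ {i j} → i ≢ j → ∀ {x y} → x ≤ k i → y ≤ k j →
         q i x ≢ q j y × (E Γ (q i x) (q j y) ⇔ ((x ≡ 0 × y ≡ 0) ⊎ (x ≡ k i × y ≡ k j)))
    cross′ {i} {j} i≢j x≤ y≤ with ℕ.<-cmp (toℕ i) (toℕ j)
    ... | tri< i<j _ _ = cross i<j x≤ y≤
    ... | tri≈ _ i≡j _ = contradiction (Fin.toℕ-injective i≡j) i≢j
    ... | tri> _ _ j<i = let ne , e = cross j<i y≤ x≤ in
      ne ∘ ≡-sym , mk⇔ (Sum.map swap swap ∘ to e ∘ E-sym Γ) (E-sym Γ ∘ from e ∘ Sum.map swap swap)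

-- One side of the homogeneous pair

-- `a` and `b` are the vertices retained in the smaller graph, `a₁a₂b₂b₁` is the square. The data
-- are symmetric in the two sides, so each result about `a` yields one about `b` through
-- `swapFrame`.
record Frame (G : Graph) (A B : Subset (n G)) : Set where
  field
    a b a₁ a₂ b₁ b₂ : V G
    a∈A      : a ∈ A
    b∈B      : b ∈ B
    a₁∈A     : a₁ ∈ A
    a₂∈A     : a₂ ∈ A
    b₁∈B     : b₁ ∈ B
    b₂∈B     : b₂ ∈ B
    A-clique : IsClique G A
    B-clique : IsClique G B
    disjoint : ∀ {v} → v ∈ A → v ∉ B
    uniformA : ∀ {v u w} → v ∉ A → v ∉ B → u ∈ A → w ∈ A → E G v u → E G v w
    uniformB : ∀ {v u w} → v ∉ A → v ∉ B → u ∈ B → w ∈ B → E G v u → E G v w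
    a≁b      : ¬ E G a b
    a₁b₁     : E G a₁ b₁
    a₂b₂     : E G a₂ b₂
    a₁≁b₂    : ¬ E G a₁ b₂
    a₂≁b₁    : ¬ E G a₂ b₁

swapFrame : ∀ {G A B} → Frame G A B → Frame G B A
swapFrame {G} F = record
  { a = b ; b = a ; a₁ = b₁ ; a₂ = b₂ ; b₁ = a₁ ; b₂ = a₂
  ; a∈A = b∈B ; b∈B = a∈A ; a₁∈A = b₁∈B ; a₂∈A = b₂∈B ; b₁∈B = a₁∈A ; b₂∈B = a₂∈A
  ; A-clique = B-clique ; B-clique = A-clique ; disjoint = λ v∈B v∈A → disjoint v∈A v∈B
  ; uniformA = λ v∉B v∉A → uniformB v∉A v∉B ; uniformB = λ v∉B v∉A → uniformA v∉A v∉B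
  ; a≁b = a≁b ∘ E-sym G ; a₁b₁ = E-sym G a₁b₁ ; a₂b₂ = E-sym G a₂b₂
  ; a₁≁b₂ = a₂≁b₁ ∘ E-sym G ; a₂≁b₁ = a₁≁b₂ ∘ E-sym G }
  where open Frame F

module OneSide (G : Graph) (A B : Subset (n G)) (clawFree : ClawFree G) (innocent : Innocent G)
  (F : Frame G A B) where
  open Frame F

  -- The set `W`: for vertices outside the pair, homogeneity reduces completeness to `A` and `B` to
  -- adjacency to `a` and `b`.
  Outer : V G → Set
  Outer v = v ∉ A × v ∉ B × ¬ (E G v a × E G v b)

  Keep : V G → Set
  Keep v = v ≡ a ⊎ (v ≡ b ⊎ Outer v)

  -- Otherwise `a₁` is the centre of a claw with leaves `c`, `d` and `b₁`: both `c` and `d` are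
  -- complete to `A`, hence anticomplete to `B`.
  nbr-clique : ∀ {c d} → Outer c → Outer d → E G c a → E G d a → c ≢ d → E G c d
  nbr-clique {c} {d} (c∉A , c∉B , c≁ab) (d∉A , d∉B , d≁ab) ca da c≢d =
    decidable-stable (E? G c d) λ c≁d → clawFree
      ( a₁ , c , d , b₁ , E-sym G (uniformA c∉A c∉B a∈A a₁∈A ca) , E-sym G (uniformA d∉A d∉B a∈A a₁∈A da)
      , a₁b₁ , c≢d , (λ { refl → c∉B b₁∈B }) , (λ { refl → d∉B b₁∈B })
      , c≁d , (λ e → c≁ab (ca , uniformB c∉A c∉B b₁∈B b∈B e))
      , (λ e → d≁ab (da , uniformB d∉A d∉B b₁∈B b∈B e)) )

  -- `a₁` and `a₂` come first because `IsClown` attaches the hat at positions 0 and 1.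
  square : Fin 4 → V G
  square = (a₁ ◂ a₂ ◂ b₂ ◂ λ _ → b₁) ∘ toℕ

  ∈A≢∈B : ∀ {u v} → u ∈ A → v ∈ B → u ≢ v
  ∈A≢∈B u∈A u∈B refl = disjoint u∈A u∈B

  a₁~a₂ : E G a₁ a₂
  a₁~a₂ = A-clique a₁ a₂ a₁∈A a₂∈A λ { refl → a₂≁b₁ a₁b₁ }

  b₂~b₁ : E G b₂ b₁
  b₂~b₁ = B-clique b₂ b₁ b₂∈B b₁∈B λ { refl → a₂≁b₁ a₂b₂ }

  square-evenHole : IsEvenHole G 4 square
  square-evenHole = closePath G (edgePath G b₂~b₁) ℕ.≤-refl a₁~a₂ at-a₁ at-a₂ , 2 , refl
    where
    at-a₁ : ∀ {i} → i ≤ 1 → a₁ ≢ (b₂ ◂ λ _ → b₁) i × (E G a₁ ((b₂ ◂ λ _ → b₁) i) ⇔ i ≡ 1)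
    at-a₁ {0} _ = ∈A≢∈B a₁∈A b₂∈B , mk⇔ (⊥-elim ∘ a₁≁b₂) λ ()
    at-a₁ {suc zero} _ = ∈A≢∈B a₁∈A b₁∈B , mk⇔ (λ _ → refl) (λ _ → a₁b₁)
    at-a₁ {suc (suc _)} (s≤s ())
    at-a₂ : ∀ {i} → i ≤ 1 → a₂ ≢ (b₂ ◂ λ _ → b₁) i × (E G a₂ ((b₂ ◂ λ _ → b₁) i) ⇔ i ≡ 0)
    at-a₂ {0} _ = ∈A≢∈B a₂∈A b₂∈B , mk⇔ (λ _ → refl) (λ _ → a₂b₂)
    at-a₂ {suc zero} _ = ∈A≢∈B a₂∈A b₁∈B , mk⇔ (⊥-elim ∘ a₂≁b₁) λ ()
    at-a₂ {suc (suc _)} (s≤s ())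

  square-side : ∀ i → ((toℕ i ≡ 0 ⊎ toℕ i ≡ 1) × square i ∈ A)
                    ⊎ (¬ (toℕ i ≡ 0 ⊎ toℕ i ≡ 1) × square i ∈ B)
  square-side zero = inj₁ (inj₁ refl , a₁∈A)
  square-side (suc zero) = inj₁ (inj₂ refl , a₂∈A)
  square-side (suc (suc zero)) = inj₂ ((λ { (inj₁ ()) ; (inj₂ ()) }) , b₂∈B)
  square-side (suc (suc (suc zero))) = inj₂ ((λ { (inj₁ ()) ; (inj₂ ()) }) , b₁∈B)

  outer≢square : ∀ {v} → Outer v → ∀ i → v ≢ square i
  outer≢square (v∉A , v∉B , _) i refl =
    [ (λ s → v∉A (proj₂ s)) , (λ s → v∉B (proj₂ s)) ]′ (square-side i)

  hat : ∀ {v} → Outer v → E G v a → ∀ i → E G v (square i) ⇔ (toℕ i ≡ 0 ⊎ toℕ i ≡ 1)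
  hat (v∉A , v∉B , ≁ab) va i with square-side i
  ... | inj₁ (i01 , ∈A) = mk⇔ (λ _ → i01) (λ _ → uniformA v∉A v∉B a∈A ∈A va)
  ... | inj₂ (¬i01 , ∈B) =
    mk⇔ (λ e → ⊥-elim (≁ab (va , uniformB v∉A v∉B ∈B b∈B e))) (⊥-elim ∘ ¬i01)

  offSquare : ∀ {v} → Outer v → ¬ E G v a → ¬ E G v b → ∀ i → ¬ E G v (square i)
  offSquare (v∉A , v∉B , _) v≁a v≁b i e with square-side i
  ... | inj₁ (_ , ∈A) = v≁a (uniformA v∉A v∉B ∈A a∈A e)
  ... | inj₂ (_ , ∈B) = v≁b (uniformB v∉A v∉B ∈B b∈B e)

  -- A shortest connection of odd length gives an odd prism with the two edges aᵢbᵢ of the square,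
  -- one of even length an odd hole through the edge a₁b₁.
  disconnected : ∀ {c d} → Walk G Outer c d → E G c a → ¬ E G d b
  disconnected walk ca db with walk⇒link G (λ v → E? G v a) (λ v → E? G v b) walk ca db
  ... | record { len = zero ; start = pa ; end = pb ; inside = ins } = proj₂ (proj₂ (ins z≤n)) (pa , pb)
  ... | record { len = suc k′ ; vtx = p ; induced = ind ; start = pa ; end = pb
               ; inside = ins ; late = late ; early = early } =
    [ (λ k-even → proj₁ innocent (3 + k , _ , oddHole , even⇒odd-suc (odd⇒even-suc (even⇒odd-suc k-even))))
    , (λ k-odd → proj₁ (proj₂ (proj₂ innocent)) (lens , _ , oddPrism , lens-odd k-odd)) ]′ (parity k)
    where
    k : ℕ
    k = suc k′
    atA : ∀ {u i} → u ∈ A → i ≤ k → u ≢ p i × (E G u (p i) ⇔ i ≡ 0)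
    atA {u} {i} u∈A i≤k with i∉A , i∉B , _ ← ins i≤k =
      (λ { refl → i∉A u∈A }) , mk⇔ (only i≤k ∘ uniformA i∉A i∉B u∈A a∈A ∘ E-sym G)
        (λ { refl → E-sym G (uniformA i∉A i∉B a∈A u∈A pa) })
      where
      only : ∀ {i} → i ≤ k → E G (p i) a → i ≡ 0
      only {zero} _ _ = refl
      only {suc i} i<k e = contradiction e (late i<k)
    atB : ∀ {u i} → u ∈ B → i ≤ k → u ≢ p i × (E G u (p i) ⇔ i ≡ k)
    atB {u} {i} u∈B i≤k with i∉A , i∉B , _ ← ins i≤k =
      (λ { refl → i∉B u∈B }) , mk⇔ (only ∘ uniformB i∉A i∉B u∈B b∈B ∘ E-sym G)
        (λ { refl → E-sym G (uniformB i∉A i∉B b∈B u∈B pb) })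
      where
      only : E G (p i) b → i ≡ k
      only e with ℕ.m≤n⇒m<n∨m≡n i≤k
      ... | inj₁ i<k = contradiction e (early i<k)
      ... | inj₂ i≡k = i≡k
    oddHole : IsHole G (3 + k) ((b₁ ◂ a₁ ◂ p) ∘ toℕ)
    oddHole = closePath G ind (s≤s z≤n) (E-sym G a₁b₁) (atB b₁∈B) (atA a₁∈A)
    lens : Fin 3 → ℕ
    lens zero = k
    lens (suc _) = 1
    paths : Fin 3 → ℕ → V G
    paths zero = p
    paths (suc zero) = a₁ ◂ λ _ → b₁
    paths (suc (suc zero)) = a₂ ◂ λ _ → b₂
    lens-odd : Odd k → ∀ i → Odd (lens i)
    lens-odd k-odd zero = k-odd
    lens-odd _ (suc _) = 0 , refl
    spoke : ∀ {α β} → α ∈ A → β ∈ B → ∀ {x y} → x ≤ k → y ≤ 1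
      → p x ≢ (α ◂ λ _ → β) y × (E G (p x) ((α ◂ λ _ → β) y) ⇔ ((x ≡ 0 × y ≡ 0) ⊎ (x ≡ k × y ≡ 1)))
    spoke α∈A β∈B {y = zero} x≤k _ = let ne , e = atA α∈A x≤k in
      ne ∘ ≡-sym , mk⇔ (λ f → inj₁ (to e (E-sym G f) , refl))
                       (λ { (inj₁ (x≡0 , _)) → E-sym G (from e x≡0) ; (inj₂ (_ , ())) })
    spoke α∈A β∈B {y = suc zero} x≤k _ = let ne , e = atB β∈B x≤k in
      ne ∘ ≡-sym , mk⇔ (λ f → inj₂ (to e (E-sym G f) , refl))
                       (λ { (inj₂ (x≡k , _)) → E-sym G (from e x≡k) ; (inj₁ (_ , ())) })
    spoke _ _ {y = suc (suc _)} _ (s≤s ())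
    rungs : ∀ {x y} → x ≤ 1 → y ≤ 1 → (a₁ ◂ λ _ → b₁) x ≢ (a₂ ◂ λ _ → b₂) y
      × (E G ((a₁ ◂ λ _ → b₁) x) ((a₂ ◂ λ _ → b₂) y) ⇔ ((x ≡ 0 × y ≡ 0) ⊎ (x ≡ 1 × y ≡ 1)))
    rungs {0} {0} _ _ = E⇒≢ G a₁~a₂ , mk⇔ (λ _ → inj₁ (refl , refl)) (λ _ → a₁~a₂)
    rungs {0} {1} _ _ = ∈A≢∈B a₁∈A b₂∈B
      , mk⇔ (⊥-elim ∘ a₁≁b₂) (λ { (inj₁ (_ , ())) ; (inj₂ (() , _)) })
    rungs {1} {0} _ _ = ∈A≢∈B a₂∈A b₁∈B ∘ ≡-sym
      , mk⇔ (⊥-elim ∘ a₂≁b₁ ∘ E-sym G) (λ { (inj₁ (() , _)) ; (inj₂ (_ , ())) })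
    rungs {1} {1} _ _ = E⇒≢ G b₂~b₁ ∘ ≡-sym
      , mk⇔ (λ _ → inj₂ (refl , refl)) (λ _ → E-sym G b₂~b₁)
    rungs {suc (suc _)} (s≤s ()) _
    rungs {y = suc (suc _)} _ (s≤s ())
    oddPrism : IsPrism G lens (λ i → paths i ∘ toℕ)
    oddPrism = prism G lens paths pos induced cross
      where
      pos : ∀ i → 1 ≤ lens i
      pos zero = s≤s z≤n
      pos (suc _) = s≤s z≤n
      induced : ∀ i → InducedPath G (lens i) (paths i)
      induced zero = ind
      induced (suc zero) = edgePath G a₁b₁
      induced (suc (suc zero)) = edgePath G a₂b₂
      cross : ∀ {i j} → i Fin.< j → ∀ {x y} → x ≤ lens i → y ≤ lens j → paths i x ≢ paths j y
        × (E G (paths i x) (paths j y) ⇔ ((x ≡ 0 × y ≡ 0) ⊎ (x ≡ lens i × y ≡ lens j)))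
      cross {zero} {suc zero} _ = spoke a₁∈A b₁∈B
      cross {zero} {suc (suc zero)} _ = spoke a₂∈A b₂∈B
      cross {suc zero} {suc (suc zero)} _ = rungs
      cross {suc zero} {suc zero} (s≤s ())
      cross {suc (suc zero)} {suc zero} (s≤s ())
      cross {suc (suc zero)} {suc (suc zero)} (s≤s (s≤s ()))

  -- The union of the components of `G[W]` that meet `C`. By `disconnected` it contains no neighbour
  -- of `b`, so a path of kept vertices that enters it from `a` never leaves it.
  Reach : V G → Set
  Reach v = ∃[ c ] E G c a × Walk G Outer c v

  reach-outer : ∀ {v} → Reach v → Outer v
  reach-outer (_ , _ , walk) = walk-end G walk

  reach≁b : ∀ {v} → Reach v → ¬ E G v b
  reach≁b (_ , ca , walk) = disconnected walk ca

  reach≢b : ∀ {v} → Reach v → v ≢ b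
  reach≢b r refl = proj₁ (proj₂ (reach-outer r)) b∈B

  reach-start : ∀ {v} → Keep v → E G v a → Reach v
  reach-start (inj₁ refl) e = ⊥-elim (E-irrefl G e)
  reach-start (inj₂ (inj₁ refl)) e = ⊥-elim (a≁b (E-sym G e))
  reach-start (inj₂ (inj₂ o)) e = _ , e , stop o

  reach-step : ∀ {u v} → Reach u → E G u v → Keep v → v ≢ a → Reach v
  reach-step r e (inj₁ v≡a) v≢a = contradiction v≡a v≢a
  reach-step r e (inj₂ (inj₁ refl)) _ = contradiction e (reach≁b r)
  reach-step (c , ca , walk) e (inj₂ (inj₂ o)) _ = c , ca , walk-snoc G walk e o

  reach-along : ∀ {m} (q : Fin (suc m) → V G) → (∀ i → E G (q (inject₁ i)) (q (suc i)))
    → (∀ i → Keep (q i)) → (∀ i → q i ≢ a) → Reach (q zero) → ∀ i → Reach (q i)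
  reach-along q edge keep ≢a r = <-weakInduction (Reach ∘ q) r
    λ i rᵢ → reach-step rᵢ (edge i) (keep (suc i)) (≢a (suc i))

  consec-inject₁ : ∀ {m} (i : Fin m) → Consec (toℕ (inject₁ i)) (suc (toℕ i))
  consec-inject₁ i = inj₁ (cong suc (Fin.toℕ-inject₁ i))

  -- Without its first vertex `a` the path becomes `q`. Only `q zero` is adjacent to `a`, so it is a
  -- hat over the square, and the rest of `q` is anticomplete to the square.
  module FromA {m} {p : Fin (2 + m) → V G} (path : IsPath G (suc m) p) (p₀ : p zero ≡ a)
    (keep : ∀ i → Keep (p i)) where

    q : Fin (suc m) → V G
    q = p ∘ suc

    q-path : IsPath G m q
    q-path = tailPath G path

    nbr-a : ∀ i → E G (q i) a ⇔ toℕ i ≡ 0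
    nbr-a i = mk⇔ (λ e → only (to edge (subst (E G (q i)) (≡-sym p₀) e)))
                  (λ e → subst (E G (q i)) p₀ (from edge (inj₂ (cong suc (≡-sym e)))))
      where
      edge : E G (q i) (p zero) ⇔ Consec (suc (toℕ i)) 0
      edge = proj₂ path (suc i) zero
      only : Consec (suc (toℕ i)) 0 → toℕ i ≡ 0
      only (inj₂ e) = ≡-sym (ℕ.suc-injective e)

    q-reach : ∀ i → Reach (q i)
    q-reach = reach-along q (λ i → from (proj₂ q-path (inject₁ i) (suc i)) (consec-inject₁ i))
      (keep ∘ suc) (λ i e → contradiction (proj₁ path (trans e (≡-sym p₀))) λ ())
      (reach-start (keep (suc zero)) (from (nbr-a zero) refl))

    q₀-hat : ∀ {i} → toℕ i ≡ 0 → ∀ j → E G (q i) (square j) ⇔ (toℕ j ≡ 0 ⊎ toℕ j ≡ 1)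
    q₀-hat {i} i≡0 = hat (reach-outer (q-reach i)) (from (nbr-a i) i≡0)

    q-off : ∀ {i} → toℕ i ≢ 0 → ∀ j → ¬ E G (q i) (square j)
    q-off {i} i≢0 = offSquare (reach-outer (q-reach i)) (i≢0 ∘ to (nbr-a i)) (reach≁b (q-reach i))

  no-a-b-path : ∀ {m p} → PathBetween G a b m p → ¬ (∀ i → Keep (p i))
  no-a-b-path {zero} (_ , p₀ , pₘ) _ =
    ∈A≢∈B a∈A b∈B (trans (≡-sym (p₀ zero refl)) (pₘ zero refl))
  no-a-b-path {suc m} (path , p₀ , pₘ) keep =
    reach≢b (FromA.q-reach path (p₀ zero refl) keep (fromℕ m)) (pₘ (fromℕ (suc m)) (Fin.toℕ-fromℕ (suc m)))

  -- As `q zero` is the hat of a clown on the square, safety of `z` makes the path from `z` to it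
  -- odd; `a` adds one edge.
  even-from-a : ∀ {z m p} → IsSafe G z → PathBetween G a z m p → (∀ i → Keep (p i)) → Even m
  even-from-a {m = zero} _ _ _ = 0 , refl
  even-from-a {z} {suc m} {p} (_ , safe) (path , p₀ , pₘ) keep =
    odd⇒even-suc (safe (q zero) 4 square clown m (q ∘ opposite) between off)
    where
    open FromA path (p₀ zero refl) keep
    clown : IsClown G (q zero) 4 square
    clown = square-evenHole , outer≢square (reach-outer (q-reach zero)) , q₀-hat refl
    between : PathBetween G z (q zero) m (q ∘ opposite)
    between = reverseBetween G (q-path , (λ { zero _ → refl }) , λ i e → pₘ (suc i) (cong suc e))
    off : ∀ x → toℕ x ≢ m → ∀ i → q (opposite x) ≢ square i × ¬ E G (q (opposite x)) (square i)
    off x x≢m i = outer≢square (reach-outer (q-reach (opposite x))) i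
      , q-off (λ e → x≢m (ℕ.≤-antisym (Fin.toℕ≤pred[n] x)
                  (ℕ.m∸n≡0⇒m≤n (trans (≡-sym (Fin.opposite-prop x)) e)))) i

  -- A path of even length from a to the hat of a clown makes a handcuff with the square and the
  -- hole of the clown, or an eye mask if a is itself the hat.
  a-safe : ∀ h k (c : Fin k → V G) → IsClown G h k c → (∀ i → Keep (c i))
    → ∀ m p → PathBetween G a h m p → (∀ i → Keep (p i))
    → (∀ x → toℕ x ≢ m → ∀ i → p x ≢ c i × ¬ E G (p x) (c i)) → Odd m
  a-safe h _ c clown@(((s≤s (s≤s (s≤s (s≤s _))) , c-inj , c-edge) , k-even) , h∉c , h-edge) keep-c
    m p (path , p₀ , pₘ) keep off =
    [ ⊥-elim ∘ notEven m p path p₀ pₘ keep off , (λ o → o) ]′ (parity m)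
    where
    hc₀ : E G h (c zero)
    hc₀ = from (h-edge zero) (inj₁ refl)
    c₀c₁ : E G (c zero) (c (suc zero))
    c₀c₁ = from (c-edge zero (suc zero)) (inj₁ (inj₁ refl))
    c-reach : (∀ i → c i ≢ a) → Reach (c zero) → ∀ i → Reach (c i)
    c-reach = reach-along c (λ i → from (c-edge (inject₁ i) (suc i)) (inj₁ (consec-inject₁ i))) keep-c
    notEven : ∀ m p → IsPath G m p → (∀ i → toℕ i ≡ 0 → p i ≡ a) → (∀ i → toℕ i ≡ m → p i ≡ h)
      → (∀ i → Keep (p i)) → (∀ x → toℕ x ≢ m → ∀ i → p x ≢ c i × ¬ E G (p x) (c i)) → ¬ Even m
    -- Here `h` is `a`, so `c zero` and `c (suc zero)` belong to `C`. Being complete to `a₁` and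
    -- `a₂`, they make an eye mask of the two holes.
    notEven zero p path p₀ pₘ keep off _ with refl ← trans (≡-sym (p₀ zero refl)) (pₘ zero refl) =
      proj₂ (proj₂ (proj₂ (proj₂ innocent)))
        ( 4 , square , _ , c , square-evenHole , proj₁ clown
        , (λ i j e → outer≢square (reach-outer (r j)) i (≡-sym e))
        , zero , suc zero , zero , suc zero , a₁~a₂ , c₀c₁
        , λ i j → mk⇔ (meet i j)
            (λ { (i01 , j01) → E-sym G (from (at j (from firstTwo j01) i) (from firstTwo i01)) }) )
      where
      r : ∀ j → Reach (c j)
      r = c-reach (λ i e → h∉c i (≡-sym e)) (reach-start (keep-c zero) (E-sym G hc₀))
      at : ∀ j → (toℕ j ≡ 0 ⊎ toℕ j ≡ 1) → ∀ i → E G (c j) (square i) ⇔ (toℕ i ≡ 0 ⊎ toℕ i ≡ 1)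
      at j j01 = hat (reach-outer (r j)) (E-sym G (from (h-edge j) j01))
      meet : ∀ i j → E G (square i) (c j) → (i ≡ zero ⊎ i ≡ suc zero) × (j ≡ zero ⊎ j ≡ suc zero)
      meet i j e with E? G h (c j)
      ... | yes hc = to firstTwo (to (at j (to (h-edge j) hc) i) (E-sym G e)) , to firstTwo (to (h-edge j) hc)
      ... | no ¬hc = ⊥-elim (offSquare (reach-outer (r j)) (¬hc ∘ E-sym G) (reach≁b (r j)) i (E-sym G e))
    -- Dropping `a` leaves an odd path `q` from a hat over the square to the hat `h` over `c`: the
    -- middle of a handcuff.
    notEven (suc m) p path p₀ pₘ keep off even =
      proj₁ (proj₂ (proj₂ (proj₂ innocent)))
        ( 4 , square , _ , c , m , q , square-evenHole , proj₁ clown , q-path , even-suc⇒odd even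
        , (λ i j e → outer≢square (reach-outer (r j)) i (≡-sym e))
        , (λ i x e → outer≢square (reach-outer (q-reach x)) i (≡-sym e))
        , (λ j x e → q≢c x j (≡-sym e))
        , (λ i j e → offSquare (reach-outer (r j)) (c≁a j) (reach≁b (r j)) i (E-sym G e))
        , (λ x x≡0 → zero , suc zero , (λ ()) , a₁~a₂
            , λ i → mk⇔ (to firstTwo ∘ to (q₀-hat x≡0 i)) (from (q₀-hat x≡0 i) ∘ from firstTwo))
        , (λ x x≡m → zero , suc zero , (λ ()) , c₀c₁
            , λ j → subst (λ v → E G v (c j) ⇔ _) (≡-sym (pₘ (suc x) (cong suc x≡m)))
                (mk⇔ (to firstTwo ∘ to (h-edge j)) (from (h-edge j) ∘ from firstTwo)))
        , (λ x i x≢0 → q-off x≢0 i)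
        , (λ x j x≢m → proj₂ (off (suc x) (x≢m ∘ ℕ.suc-injective) j)) )
      where
      open FromA path (p₀ zero refl) keep
      c≢a : ∀ j → c j ≢ a
      c≢a j e = proj₁ (off zero (λ ()) j) (trans (p₀ zero refl) (≡-sym e))
      c≁a : ∀ j → ¬ E G (c j) a
      c≁a j e = proj₂ (off zero (λ ()) j) (subst (λ v → E G v (c j)) (≡-sym (p₀ zero refl)) (E-sym G e))
      h-reach : Reach h
      h-reach = subst Reach (pₘ (fromℕ (suc m)) (Fin.toℕ-fromℕ (suc m))) (q-reach (fromℕ m))
      -- The hole avoids `a`, where `p` starts, and is entered from `h`; hence it is confined to
      -- `Reach` as well.
      r : ∀ j → Reach (c j)
      r = c-reach c≢a (reach-step h-reach hc₀ (keep-c zero) (c≢a zero))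
      q≢c : ∀ x j → q x ≢ c j
      q≢c x j e with toℕ x ℕ.≟ m
      ... | yes x≡m = h∉c j (trans (≡-sym (pₘ (suc x) (cong suc x≡m))) e)
      ... | no x≢m = proj₁ (off (suc x) (x≢m ∘ ℕ.suc-injective) j) e

-- Induced subgraphs and the reduction

does⇒ : ∀ {ℓ} {P : Set ℓ} (P? : Dec P) → does P? ≡ true → P
does⇒ (yes p) _ = p

comprehend : ∀ {m ℓ} {P : Pred (Fin m) ℓ} → Decidable P → Subset m
comprehend P? = tabulate (does ∘ P?)

∈-comprehend : ∀ {m ℓ} {P : Pred (Fin m) ℓ} (P? : Decidable P) {v} → v ∈ comprehend P? ⇔ P v
∈-comprehend P? {v} = mk⇔
  (λ v∈ → does⇒ (P? v) (trans (≡-sym (lookup∘tabulate _ v)) ([]=⇒lookup v∈)))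
  (λ Pv → lookup⇒[]= v _ (trans (lookup∘tabulate _ v) (dec-true (P? v) Pv)))

member : ∀ {m} (s : Subset m) → Fin ∣ s ∣ → Fin m
member (true ∷ s) zero = zero
member (true ∷ s) (suc i) = suc (member s i)
member (false ∷ s) i = suc (member s i)

member-∈ : ∀ {m} (s : Subset m) i → member s i ∈ s
member-∈ (true ∷ s) zero = here
member-∈ (true ∷ s) (suc i) = there (member-∈ s i)
member-∈ (false ∷ s) i = there (member-∈ s i)

member-injective : ∀ {m} (s : Subset m) {i j} → member s i ≡ member s j → i ≡ j
member-injective (true ∷ s) {zero} {zero} _ = refl
member-injective (true ∷ s) {suc i} {suc j} e = cong suc (member-injective s (Fin.suc-injective e))
member-injective (false ∷ s) e = member-injective s (Fin.suc-injective e)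

member-onto : ∀ {m} (s : Subset m) {v} → v ∈ s → ∃[ i ] member s i ≡ v
member-onto (true ∷ s) here = zero , refl
member-onto (true ∷ s) (there v∈s) with i , refl ← member-onto s v∈s = suc i , refl
member-onto (false ∷ s) (there v∈s) with i , refl ← member-onto s v∈s = i , refl

module Induced (G : Graph) (s : Subset (n G)) where

  -- Adjacency is by definition that of the images in `G`, so edge conditions transfer unchanged and
  -- only distinctness calls for `ι-inj`.
  H : Graph
  H = record
    { n = ∣ s ∣ ; adj = λ i j → adj G (member s i) (member s j)
    ; sym = λ i j → Graph.sym G (member s i) (member s j) ; irrefl = λ i → irrefl G (member s i) }

  ι : V H → V G
  ι = member s

  ι-inj : ∀ {i j} → ι i ≡ ι j → i ≡ j
  ι-inj = member-injective s

  evenHole↑ : ∀ {k c} → IsEvenHole H k c → IsEvenHole G k (ι ∘ c)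
  evenHole↑ ((4≤k , inj , edge) , even) = (4≤k , inj ∘ ι-inj , edge) , even

  path↑ : ∀ {k p} → IsPath H k p → IsPath G k (ι ∘ p)
  path↑ (inj , edge) = inj ∘ ι-inj , edge

  between↑ : ∀ {i j u v k p} → ι i ≡ u → ι j ≡ v → PathBetween H i j k p → PathBetween G u v k (ι ∘ p)
  between↑ refl refl (path , p₀ , pₖ) = path↑ path , (λ x e → cong ι (p₀ x e)) , (λ x e → cong ι (pₖ x e))

  clown↑ : ∀ {h k c} → IsClown H h k c → IsClown G (ι h) k (ι ∘ c)
  clown↑ (hole , h∉c , edge) = evenHole↑ hole , (λ i → h∉c i ∘ ι-inj) , edge

  clawFree↓ : ClawFree G → ClawFree H
  clawFree↓ noClaw (c , x , y , z , cx , cy , cz , x≢y , x≢z , y≢z , ¬e) =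
    noClaw (ι c , ι x , ι y , ι z , cx , cy , cz , x≢y ∘ ι-inj , x≢z ∘ ι-inj , y≢z ∘ ι-inj , ¬e)

  innocent↓ : Innocent G → Innocent H
  innocent↓ (noOddHole , noAntihole , noPrism , noHandcuff , noEyeMask) =
      (λ { (k , c , (4≤k , inj , edge) , odd) → noOddHole (k , ι ∘ c , (4≤k , inj ∘ ι-inj , edge) , odd) })
    , (λ { (k , c , (4≤k , inj , edge) , 6≤k) → noAntihole (k , ι ∘ c , (4≤k , inj ∘ ι-inj , edge) , 6≤k) })
    , (λ { (k , p , (pos , path , disj , edge) , odd) → noPrism
           (k , (λ i → ι ∘ p i) , (pos , path↑ ∘ path , (λ i j i≢j x y → disj i j i≢j x y ∘ ι-inj) , edge) , odd) })
    , (λ { (k₁ , c₁ , k₂ , c₂ , m , q , hole₁ , hole₂ , path , odd , d₁₂ , d₁ , d₂ , rest) → noHandcuff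
           (k₁ , ι ∘ c₁ , k₂ , ι ∘ c₂ , m , ι ∘ q , evenHole↑ hole₁ , evenHole↑ hole₂ , path↑ path , odd
           , (λ i j → d₁₂ i j ∘ ι-inj) , (λ i x → d₁ i x ∘ ι-inj) , (λ j x → d₂ j x ∘ ι-inj) , rest) })
    , (λ { (k₁ , c₁ , k₂ , c₂ , hole₁ , hole₂ , d₁₂ , rest) → noEyeMask
           (k₁ , ι ∘ c₁ , k₂ , ι ∘ c₂ , evenHole↑ hole₁ , evenHole↑ hole₂ , (λ i j → d₁₂ i j ∘ ι-inj) , rest) })

  safe↓ : ∀ {i} → IsSafe G (ι i) → IsSafe H i
  safe↓ (simplicial , odd) =
      (λ x y ix iy x≢y → simplicial (ι x) (ι y) ix iy (x≢y ∘ ι-inj))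
    , (λ h k c clown m p between off → odd (ι h) k (ι ∘ c) (clown↑ clown) m (ι ∘ p) (between↑ refl refl between)
         (λ x x≢m a → let ne , ¬e = off x x≢m a in ne ∘ ι-inj , ¬e))

maximal-∈ : ∀ Γ {K v} → IsMaximalClique Γ K → (∀ {k} → k ∈ K → k ≢ v → E Γ v k) → v ∈ K
maximal-∈ Γ {K} {v} (clique , maximal) ~K =
  maximal (K ∪ ⁅ v ⁆) clique′ (p⊆p∪q _) (x∈p∪q⁺ (inj₂ (x∈⁅x⁆ v)))
  where
  clique′ : IsClique Γ (K ∪ ⁅ v ⁆)
  clique′ x y x∈ y∈ x≢y with x∈p∪q⁻ K ⁅ v ⁆ x∈ | x∈p∪q⁻ K ⁅ v ⁆ y∈
  ... | inj₁ x∈K | inj₁ y∈K = clique x y x∈K y∈K x≢y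
  ... | inj₁ x∈K | inj₂ y=v with refl ← x∈⁅y⁆⇒x≡y v y=v = E-sym Γ (~K x∈K x≢y)
  ... | inj₂ x=v | inj₁ y∈K with refl ← x∈⁅y⁆⇒x≡y v x=v = ~K y∈K (x≢y ∘ ≡-sym)
  ... | inj₂ x=v | inj₂ y=v =
    contradiction (trans (x∈⁅y⁆⇒x≡y v x=v) (≡-sym (x∈⁅y⁆⇒x≡y v y=v))) x≢y

∉-maximal : ∀ Γ {K v} → IsMaximalClique Γ K → v ∉ K → ¬ ¬ (∃[ k ] k ∈ K × k ≢ v × ¬ E Γ v k)
∉-maximal Γ {v = v} max v∉K none = v∉K (maximal-∈ Γ max λ {k} k∈K k≢v →
  decidable-stable (E? Γ v k) λ ¬vk → none (k , k∈K , k≢v , ¬vk))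

-- The hypothesis `bisimplicial` says that `ab` is a bisimplicial edge of the bipartite complement
-- of `G[A ∪ B]`.
module Reduction (G : Graph) (Z : Subset (n G)) (cand : IsCandidate G Z) {A B : Subset (n G)}
  (F : Frame G A B)
  (bisimplicial : ∀ {u v} → u ∈ A → v ∈ B → ¬ E G u (Frame.b F) → ¬ E G (Frame.a F) v → ¬ E G u v)
  where

  open Frame F

  clawFree : ClawFree G
  clawFree = proj₁ cand
  innocent : Innocent G
  innocent = proj₁ (proj₂ cand)
  consistent : IsConsistent G Z
  consistent = proj₁ (proj₂ (proj₂ cand))
  Z-safe : ∀ v → v ∈ Z → IsSafe G v
  Z-safe = proj₁ (proj₂ (proj₂ (proj₂ cand)))

  module A-side = OneSide G A B clawFree innocent F
  module B-side = OneSide G B A clawFree innocent (swapFrame F)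
  open A-side using (Outer; Keep)

  outer-swap : ∀ {v} → Outer v → B-side.Outer v
  outer-swap (v∉A , v∉B , ≁ab) = v∉B , v∉A , ≁ab ∘ swap

  keep-swap : ∀ {v} → Keep v → B-side.Keep v
  keep-swap (inj₁ v≡a) = inj₂ (inj₁ v≡a)
  keep-swap (inj₂ (inj₁ v≡b)) = inj₁ v≡b
  keep-swap (inj₂ (inj₂ o)) = inj₂ (inj₂ (outer-swap o))

  outer? : Decidable Outer
  outer? v = ¬? (v ∈? A) ×-dec ¬? (v ∈? B) ×-dec ¬? (E? G v a ×-dec E? G v b)

  keep? : Decidable Keep
  keep? v = (v Fin.≟ a) ⊎-dec (v Fin.≟ b) ⊎-dec outer? v

  open Induced G (comprehend keep?) public

  ι-keep : ∀ i → Keep (ι i)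
  ι-keep i = to (∈-comprehend keep?) (member-∈ (comprehend keep?) i)

  ι-onto : ∀ {v} → Keep v → ∃[ i ] ι i ≡ v
  ι-onto k = member-onto (comprehend keep?) (from (∈-comprehend keep?) k)

  -- `Keep` retains only `a` from `A`, whereas `a₁` and `a₂` are distinct, so one of them is lost.
  smaller : n H < n G
  smaller = subst (∣ comprehend keep? ∣ <_) (∣⊤∣≡n (n G))
    (p⊂q⇒∣p∣<∣q∣ ((λ _ → ∈⊤) , dropped))
    where
    drop : ∀ {v} → v ∈ A → v ≢ a → ∃[ v ] v ∈ ⊤ × v ∉ comprehend keep?
    drop {v} v∈A v≢a = v , ∈⊤ , λ v∈ → gone (to (∈-comprehend keep?) v∈)
      where
      gone : ¬ Keep v
      gone (inj₁ v≡a) = v≢a v≡a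
      gone (inj₂ (inj₁ refl)) = disjoint v∈A b∈B
      gone (inj₂ (inj₂ (v∉A , _))) = v∉A v∈A
    dropped : ∃[ v ] v ∈ ⊤ × v ∉ comprehend keep?
    dropped with a₁ Fin.≟ a
    ... | no a₁≢a = drop a₁∈A a₁≢a
    ... | yes refl = drop a₂∈A (E⇒≢ G A-side.a₁~a₂ ∘ ≡-sym)

  Special : V G → Set
  Special v = v ∈ Z ⊎ (v ≡ a ⊎ v ≡ b)

  special? : Decidable Special
  special? v = (v ∈? Z) ⊎-dec (v Fin.≟ a) ⊎-dec (v Fin.≟ b)

  Z′ : Subset (n H)
  Z′ = comprehend (special? ∘ ι)

  -- Consistency also covers pairs of equal vertices, which only a path of length 0 joins.
  closed-even : ∀ {v m p} → PathBetween G v v m p → Even m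
  closed-even {m = m} ((inj , _) , p₀ , pₘ) = 0 , trans (≡-sym (Fin.toℕ-fromℕ m))
    (cong toℕ (inj (trans (pₘ (fromℕ m) (Fin.toℕ-fromℕ m)) (≡-sym (p₀ zero refl)))))

  even-between : ∀ {u v m p} → Special u → Special v → PathBetween G u v m p → (∀ i → Keep (p i)) → Even m
  even-between (inj₁ u∈Z) (inj₁ v∈Z) path _ = consistent _ _ u∈Z v∈Z _ _ path
  even-between (inj₁ u∈Z) (inj₂ (inj₁ refl)) path keep =
    A-side.even-from-a (Z-safe _ u∈Z) (reverseBetween G path) (keep ∘ opposite)
  even-between (inj₁ u∈Z) (inj₂ (inj₂ refl)) path keep =
    B-side.even-from-a (Z-safe _ u∈Z) (reverseBetween G path) (keep-swap ∘ keep ∘ opposite)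
  even-between (inj₂ (inj₁ refl)) (inj₁ v∈Z) path keep = A-side.even-from-a (Z-safe _ v∈Z) path keep
  even-between (inj₂ (inj₂ refl)) (inj₁ v∈Z) path keep =
    B-side.even-from-a (Z-safe _ v∈Z) path (keep-swap ∘ keep)
  even-between (inj₂ (inj₁ refl)) (inj₂ (inj₁ refl)) path _ = closed-even path
  even-between (inj₂ (inj₂ refl)) (inj₂ (inj₂ refl)) path _ = closed-even path
  even-between (inj₂ (inj₁ refl)) (inj₂ (inj₂ refl)) path keep = ⊥-elim (A-side.no-a-b-path path keep)
  even-between (inj₂ (inj₂ refl)) (inj₂ (inj₁ refl)) path keep =
    ⊥-elim (B-side.no-a-b-path path (keep-swap ∘ keep))

  consistent′ : IsConsistent H Z′
  consistent′ i j i∈ j∈ m p path = even-between (to (∈-comprehend (special? ∘ ι)) i∈)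
    (to (∈-comprehend (special? ∘ ι)) j∈) (between↑ refl refl path) (ι-keep ∘ p)

  -- Quantifying over the frame lets one argument serve both `a` and `b`.
  frame-safe : ∀ {X Y} (F′ : Frame G X Y)
    → (∀ {v} → Keep v → OneSide.Keep G X Y clawFree innocent F′ v) → ∀ {i} → ι i ≡ Frame.a F′ → IsSafe H i
  frame-safe {X} {Y} F′ keep {i} i≡a =
      (λ x y ix iy x≢y → S.nbr-clique (outer ix) (outer iy) (~a ix) (~a iy) (x≢y ∘ ι-inj))
    , (λ h k c clown m p path off → S.a-safe (ι h) k (ι ∘ c) (clown↑ clown) (kept ∘ c) m (ι ∘ p)
         (between↑ i≡a refl path) (kept ∘ p) (λ x x≢m j → let ne , ¬e = off x x≢m j in ne ∘ ι-inj , ¬e))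
    where
    module S = OneSide G X Y clawFree innocent F′
    kept : ∀ x → S.Keep (ι x)
    kept x = keep (ι-keep x)
    ~a : ∀ {x} → E G (ι i) (ι x) → E G (ι x) (Frame.a F′)
    ~a {x} e = subst (E G (ι x)) i≡a (E-sym G e)
    outer : ∀ {x} → E G (ι i) (ι x) → S.Outer (ι x)
    outer {x} e = S.reach-outer (S.reach-start (kept x) (~a e))

  safe′ : ∀ i → i ∈ Z′ → IsSafe H i
  safe′ i i∈ with to (∈-comprehend (special? ∘ ι)) i∈
  ... | inj₁ i∈Z = safe↓ (Z-safe _ i∈Z)
  ... | inj₂ (inj₁ i≡a) = frame-safe F (λ k → k) i≡a
  ... | inj₂ (inj₂ i≡b) = frame-safe (swapFrame F) keep-swap i≡b

  module Lift (S′ : Subset (n H)) (strong : IsStrongStable H S′) (Z′⊆S′ : Z′ ⊆ S′)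
    (Z-outer : ∀ {z} → z ∈ Z → Outer z) where

    image? : Decidable (λ v → ∃[ i ] i ∈ S′ × ι i ≡ v)
    image? v = Fin.any? λ i → (i ∈? S′) ×-dec (ι i Fin.≟ v)

    S : Subset (n G)
    S = comprehend image?

    ∈S : ∀ {v} → Keep v → Special v → v ∈ S
    ∈S k sp with i , refl ← ι-onto k =
      from (∈-comprehend image?) (i , Z′⊆S′ (from (∈-comprehend (special? ∘ ι)) sp) , refl)

    stable : IsStable G S
    stable x y x∈ y∈ with to (∈-comprehend image?) x∈ | to (∈-comprehend image?) y∈
    ... | i , i∈ , refl | j , j∈ , refl = proj₁ strong i j i∈ j∈

    -- Suppose `f` misses both `a` and `b`. By homogeneity `k` is in neither `A` nor `B`, so, not
    -- being outer, it is adjacent to both `a` and `b` and is the centre of a claw with leaves `a`,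
    -- `b`, `f`.
    no-far : ∀ {K k f} → IsClique G K → k ∈ K → ¬ Outer k → f ∈ K
      → f ∉ A → f ∉ B → ¬ E G f a → ¬ ¬ E G f b
    no-far {K} {k} {f} clique k∈K ¬ok f∈K f∉A f∉B f≁a f≁b with k ∈? A | k ∈? B
    ... | yes k∈A | _ = f≁a (uniformA f∉A f∉B k∈A a∈A (clique f k f∈K k∈K λ { refl → f∉A k∈A }))
    ... | no _ | yes k∈B = f≁b (uniformB f∉A f∉B k∈B b∈B (clique f k f∈K k∈K λ { refl → f∉B k∈B }))
    ... | no k∉A | no k∉B = ¬ok (k∉A , k∉B , λ { (ka , kb) → clawFree
      ( k , a , b , f , ka , kb , clique k f k∈K f∈K (λ { refl → f≁a ka })
      , A-side.∈A≢∈B a∈A b∈B , (λ { refl → f∉A a∈A }) , (λ { refl → f∉B b∈B })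
      , a≁b , f≁a ∘ E-sym G , f≁b ∘ E-sym G ) })

    -- Maximality yields `u` and `v` in `K` missing `a` and `b` respectively, so `u` is not in `A`
    -- and `v` not in `B`. If `u` is in `B` and `v` in `A`, `bisimplicial` applies; if exactly one
    -- is in the pair, homogeneity does. If neither is, `no-far` forces `u` to see `b` and `v` to
    -- see `a`.
    all-outer : ∀ {K} → IsMaximalClique G K → a ∉ K → b ∉ K → ∀ {k} → k ∈ K → Outer k
    all-outer {K} max@(clique , _) a∉K b∉K {k₀} k₀∈K = decidable-stable (outer? k₀) λ ¬o →
      ∉-maximal G max a∉K λ { (u , u∈K , u≢a , a≁u) → ∉-maximal G max b∉K λ { (v , v∈K , v≢b , b≁v) →
        clash ¬o u∈K u≢a a≁u v∈K v≢b b≁v } }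
      where
      clash : ∀ {u v} → ¬ Outer k₀ → u ∈ K → u ≢ a → ¬ E G a u → v ∈ K → v ≢ b → ¬ E G b v → ⊥
      clash {u} {v} ¬o u∈K u≢a a≁u v∈K v≢b b≁v with u ∈? A | u ∈? B | v ∈? A | v ∈? B
      ... | yes u∈A | _ | _ | _ = a≁u (A-clique a u a∈A u∈A (u≢a ∘ ≡-sym))
      ... | no _ | _ | _ | yes v∈B = b≁v (B-clique b v b∈B v∈B (v≢b ∘ ≡-sym))
      ... | no _ | yes u∈B | yes v∈A | no _ =
        bisimplicial v∈A u∈B (b≁v ∘ E-sym G) a≁u (clique v u v∈K u∈K (A-side.∈A≢∈B v∈A u∈B))
      ... | no _ | yes u∈B | no v∉A | no v∉B =
        b≁v (E-sym G (uniformB v∉A v∉B u∈B b∈B (clique v u v∈K u∈K λ { refl → v∉B u∈B })))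
      ... | no u∉A | no u∉B | yes v∈A | no _ =
        a≁u (E-sym G (uniformA u∉A u∉B v∈A a∈A (clique u v u∈K v∈K λ { refl → u∉A v∈A })))
      ... | no u∉A | no u∉B | no v∉A | no v∉B =
        no-far clique k₀∈K ¬o u∈K u∉A u∉B (a≁u ∘ E-sym G) λ ub →
        no-far′ λ va →
        -- The edge `vu` now joins `C` to `D` within `W`.
        A-side.disconnected
          (step (v∉A , v∉B , b≁v ∘ E-sym G ∘ proj₂) (clique v u v∈K u∈K λ { refl → b≁v (E-sym G ub) })
            (stop (u∉A , u∉B , a≁u ∘ E-sym G ∘ proj₁)))
          va ub
        where
        no-far′ : ¬ ¬ E G v a
        no-far′ v≁a = no-far clique k₀∈K ¬o v∈K v∉A v∉B v≁a (b≁v ∘ E-sym G)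

    -- `S` contains `a` and `b`, so only a clique avoiding both is at stake. It lies in `W` by
    -- `all-outer`, hence its preimage `K′` is a maximal clique of `H` and meets `S′`.
    meets : ∀ K → IsMaximalClique G K → (∃[ v ] v ∈ K) → ∃[ v ] v ∈ S × v ∈ K
    meets K max@(clique , _) (k , k∈K) =
      decidable-stable (Fin.any? λ v → (v ∈? S) ×-dec (v ∈? K)) λ none →
        let outer = all-outer max
              (λ a∈K → none (a , ∈S (inj₁ refl) (inj₂ (inj₁ refl)) , a∈K))
              (λ b∈K → none (b , ∈S (inj₂ (inj₁ refl)) (inj₂ (inj₂ refl)) , b∈K))
            pre : ∀ {v} → v ∈ K → ∃[ i ] ι i ≡ v
            pre v∈K = ι-onto (inj₂ (inj₂ (outer v∈K)))
            i , i∈S′ , i∈K′ = proj₂ strong K′ (K′-clique , K′-maximal pre) (K′-nonempty (pre k∈K))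
        in none (ι i , from (∈-comprehend image?) (i , i∈S′ , refl) , to ∈K′ i∈K′)
      where
      K′ : Subset (n H)
      K′ = comprehend (λ i → ι i ∈? K)
      ∈K′ : ∀ {i} → i ∈ K′ ⇔ ι i ∈ K
      ∈K′ = ∈-comprehend (λ i → ι i ∈? K)
      K′-clique : IsClique H K′
      K′-clique i j i∈ j∈ i≢j = clique (ι i) (ι j) (to ∈K′ i∈) (to ∈K′ j∈) (i≢j ∘ ι-inj)
      K′-nonempty : (∃[ i ] ι i ≡ k) → ∃[ i ] i ∈ K′
      K′-nonempty (i , refl) = i , from ∈K′ k∈K
      K′-maximal : (∀ {v} → v ∈ K → ∃[ i ] ι i ≡ v) → ∀ T → IsClique H T → K′ ⊆ T → T ⊆ K′
      K′-maximal pre T T-clique K′⊆T {j} j∈T = from ∈K′ (maximal-∈ G max λ v∈K v≢j → adjacent v∈K v≢j (pre v∈K))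
        where
        adjacent : ∀ {v} → v ∈ K → v ≢ ι j → (∃[ i ] ι i ≡ v) → E G (ι j) v
        adjacent v∈K v≢j (i , refl) = T-clique j i j∈T (K′⊆T (from ∈K′ v∈K)) λ { refl → v≢j refl }

    Z⊆S : Z ⊆ S
    Z⊆S z∈Z = ∈S (inj₂ (inj₂ (Z-outer z∈Z))) (inj₁ z∈Z)

  candidate′ : (∀ {z} → z ∈ Z → Outer z) → IsCandidate H Z′
  candidate′ Z-outer = clawFree↓ clawFree , innocent↓ innocent , consistent′ , safe′
    , notStrong
    where
    notStrong : ¬ (∃[ S′ ] IsStrongStable H S′ × Z′ ⊆ S′)
    notStrong (S′ , strong , Z′⊆S′) = proj₂ (proj₂ (proj₂ (proj₂ cand))) (S , (stable , meets) , Z⊆S)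
      where
      open Lift S′ strong Z′⊆S′ Z-outer

-- The complement of the homogeneous pair

module CoBipartite (G : Graph) {A B : Subset (n G)} (A-clique : IsClique G A) (B-clique : IsClique G B)
  (disjoint : ∀ {v} → v ∈ A → v ∉ B) where

  Cross : V G → V G → Set
  Cross u v = ((u ∈ A × v ∈ B) ⊎ (u ∈ B × v ∈ A)) × ¬ E G u v

  cross? : ∀ u v → Dec (Cross u v)
  cross? u v = (((u ∈? A) ×-dec (v ∈? B)) ⊎-dec ((u ∈? B) ×-dec (v ∈? A))) ×-dec ¬? (E? G u v)

  cross-sym : ∀ {u v} → Cross u v → Cross v u
  cross-sym (sides , ¬uv) = Sum.swap (Sum.map swap swap sides) , ¬uv ∘ E-sym G

  cross-irrefl : ∀ {v} → ¬ Cross v v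
  cross-irrefl (inj₁ (v∈A , v∈B) , _) = disjoint v∈A v∈B
  cross-irrefl (inj₂ (v∈B , v∈A) , _) = disjoint v∈A v∈B

  -- The bipartite complement of `G[A ∪ B]`, kept on all vertices of `G`; those outside `A ∪ B` are
  -- isolated.
  H : Graph
  H = record
    { n = n G ; adj = λ u v → does (cross? u v)
    ; sym = λ u v → does-⇔ (mk⇔ cross-sym cross-sym) (cross? u v) (cross? v u)
    ; irrefl = λ v → dec-false (cross? v v) cross-irrefl }

  H⇔ : ∀ {u v} → E H u v ⇔ Cross u v
  H⇔ {u} {v} = mk⇔ (does⇒ (cross? u v)) (dec-true (cross? u v))

  col : V G → Bool
  col v = does (v ∈? A)

  bip : ∀ {u v} → E H u v → col u ≢ col v
  bip {u} {v} e same with to H⇔ e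
  ... | inj₁ (u∈A , v∈B) , _ =
    disjoint (does⇒ (v ∈? A) (trans (≡-sym same) (dec-true (u ∈? A) u∈A))) v∈B
  ... | inj₂ (u∈B , v∈A) , _ =
    disjoint (does⇒ (u ∈? A) (trans same (dec-true (v ∈? A) v∈A))) u∈B

  -- Each vertex of the hole has a neighbour in `H`, so it lies in `A ∪ B`, where distinct vertices
  -- are adjacent in `G` exactly if they are not adjacent in `H`.
  hole⇒antihole : ∀ {k} (c : Fin k → V G) → IsHole H k c → IsAntihole G k c
  hole⇒antihole {suc (suc k)} c (4≤k , inj , edge) = 4≤k , inj , λ i j → mk⇔
      (λ e → (λ { refl → E-irrefl G e }) , λ cyc → proj₂ (to H⇔ (from (edge i j) cyc)) e)
      (λ { (i≢j , ¬cyc) → nonCross (side i) (side j) (λ e → i≢j (inj e)) (¬cyc ∘ to (edge i j) ∘ from H⇔) })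
    where
    neighbour : ∀ i → ∃[ j ] CycAdj (2 + k) (toℕ i) (toℕ j)
    neighbour zero = suc zero , inj₁ (inj₁ refl)
    neighbour (suc i) = inject₁ i , inj₁ (inj₂ (cong suc (Fin.toℕ-inject₁ i)))
    side : ∀ i → c i ∈ A ⊎ c i ∈ B
    side i with j , cyc ← neighbour i = Sum.map proj₁ proj₁ (proj₁ (to H⇔ (from (edge i j) cyc)))
    nonCross : ∀ {u v} → u ∈ A ⊎ u ∈ B → v ∈ A ⊎ v ∈ B → u ≢ v → ¬ Cross u v → E G u v
    nonCross (inj₁ u∈A) (inj₁ v∈A) u≢v _ = A-clique _ _ u∈A v∈A u≢v
    nonCross (inj₂ u∈B) (inj₂ v∈B) u≢v _ = B-clique _ _ u∈B v∈B u≢v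
    nonCross (inj₁ u∈A) (inj₂ v∈B) _ ¬cross = decidable-stable (E? G _ _) λ ¬e → ¬cross (inj₁ (u∈A , v∈B) , ¬e)
    nonCross (inj₂ u∈B) (inj₁ v∈A) _ ¬cross = decidable-stable (E? G _ _) λ ¬e → ¬cross (inj₂ (u∈B , v∈A) , ¬e)
  hole⇒antihole {zero} _ (() , _)
  hole⇒antihole {suc zero} _ (s≤s () , _)

  bisimplicialPair : ¬ HasLongAntihole G → ∀ {u v} → u ∈ A → v ∈ B → ¬ E G u v
    → ¬ (∀ {a b} → a ∈ A → b ∈ B → ¬ E G a b
           → ¬ (∀ {u v} → u ∈ A → v ∈ B → ¬ E G u b → ¬ E G a v → ¬ E G u v))
  bisimplicialPair noAntihole u∈A v∈B ¬uv noPair =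
    bisimplicialEdge (from H⇔ (inj₁ (u∈A , v∈B) , ¬uv)) λ xy bis → oriented (to H⇔ xy) bis
    where
    open ChordalBipartite H col bip (λ c hole 6≤k → noAntihole (_ , c , hole⇒antihole c hole , 6≤k))
    -- The bisimplicial edge may have its first end on either side; the conclusion always names the
    -- end in `A` first.
    oriented : ∀ {x y} → Cross x y → ¬ IsBisimplicial H x y
    oriented (inj₁ (x∈A , y∈B) , ¬xy) bis = noPair x∈A y∈B ¬xy λ u∈A v∈B ¬ub ¬av →
      proj₂ (to H⇔ (bis (from H⇔ (inj₂ (y∈B , u∈A) , ¬ub ∘ E-sym G)) (from H⇔ (inj₁ (x∈A , v∈B) , ¬av))))
    oriented (inj₂ (x∈B , y∈A) , ¬xy) bis = noPair y∈A x∈B (¬xy ∘ E-sym G) λ u∈A v∈B ¬ub ¬av →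
      proj₂ (to H⇔ (bis (from H⇔ (inj₁ (y∈A , v∈B) , ¬av)) (from H⇔ (inj₂ (x∈B , u∈A) , ¬ub ∘ E-sym G)))) ∘ E-sym G

-- Moving from u to a neighbour of one of its non-neighbours enlarges the neighbourhood in B
-- as long as no square shows up.
square-exists : ∀ G {A B} → IsProper G A B → ∀ {u} → u ∈ A
  → ¬ (∀ {a₁ a₂ b₁ b₂} → a₁ ∈ A → a₂ ∈ A → b₁ ∈ B → b₂ ∈ B
         → E G a₁ b₁ → E G a₂ b₂ → ¬ E G a₁ b₂ → E G a₂ b₁)
square-exists G {A} {B} (mixedA , mixedB) u∈A noSquare = climb ⊤ (<-wellFounded _) u∈A (λ _ _ → ∈⊤)
  where
  climb : ∀ r → Acc _<_ ∣ r ∣ → ∀ {u} → u ∈ A → ¬ (∀ {b} → b ∈ B → ¬ E G u b → b ∈ r)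
  climb r (acc rs) {u} u∈A misses
    with _ , b′ , b′∈B , ¬ub′ ← mixedA u u∈A
    with (a′ , a′∈A , b′a′) , _ ← mixedB b′ b′∈B =
    climb (r - b′) (rs (x∈p⇒∣p-x∣<∣p∣ (misses b′∈B ¬ub′))) a′∈A λ b∈B ¬a′b →
      x∈p∧x≢y⇒x∈p-y
        (misses b∈B λ ub → ¬a′b (noSquare u∈A a′∈A b∈B b′∈B ub (E-sym G b′a′) ¬ub′))
        λ { refl → ¬a′b (E-sym G b′a′) }

theorem4p3 : (G : Graph) (Z : Subset (n G)) → IsSuspect G Z → ¬ AdmitsProperCoherentWJoin G
theorem4p3 G Z (cand , minimal)
  (A , B , ((A-clique , B-clique , disjoint , homogeneous) , notComplete , _) , _ , proper@(mixedA , mixedB)) =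
  -- Refuting a nonadjacent pair across `A` and `B` is enough, so the doubly negated pair `ab` and
  -- square can be unpacked in turn.
  notComplete λ u v u∈A v∈B → decidable-stable (E? G u v) λ ¬uv →
    CoBipartite.bisimplicialPair G A-clique B-clique (disjoint _) noAntihole u∈A v∈B ¬uv
      λ {a} {b} a∈A b∈B a≁b bisimplicial → square-exists G proper a∈A
        λ {a₁} {a₂} {b₁} {b₂} a₁∈A a₂∈A b₁∈B b₂∈B a₁b₁ a₂b₂ a₁≁b₂ → decidable-stable (E? G a₂ b₁) λ a₂≁b₁ →
          let F : Frame G A B
              F = record
                { a = a ; b = b ; a₁ = a₁ ; a₂ = a₂ ; b₁ = b₁ ; b₂ = b₂ ; a∈A = a∈A ; b∈B = b∈B
                ; a₁∈A = a₁∈A ; a₂∈A = a₂∈A ; b₁∈B = b₁∈B ; b₂∈B = b₂∈B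
                ; A-clique = A-clique ; B-clique = B-clique ; disjoint = disjoint _
                ; uniformA = λ v∉A v∉B u∈A w∈A vu →
                    uniform (proj₁ (homogeneous _ v∉A v∉B)) u∈A w∈A vu
                ; uniformB = λ v∉A v∉B u∈B w∈B vu →
                    uniform (proj₂ (homogeneous _ v∉A v∉B)) u∈B w∈B vu
                ; a≁b = a≁b ; a₁b₁ = a₁b₁ ; a₂b₂ = a₂b₂ ; a₁≁b₂ = a₁≁b₂ ; a₂≁b₁ = a₂≁b₁ }
              open Reduction G Z cand F bisimplicial
          -- Members of `Z` are simplicial: none lies in `A` or `B`, and none is adjacent to both of
          -- the nonadjacent `a` and `b`. So `Z` lies in `W`.
          in ℕ.<⇒≱ smaller (minimal H Z′ (candidate′ λ z∈Z →
               (λ z∈A → notSimplicialA z∈A (simplicial z∈Z)) , (λ z∈B → notSimplicialB z∈B (simplicial z∈Z))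
               , λ { (za , zb) → a≁b (simplicial z∈Z a b za zb λ { refl → disjoint _ a∈A b∈B }) }))
  where
  noAntihole : ¬ HasLongAntihole G
  noAntihole = proj₁ (proj₂ (proj₁ (proj₂ cand)))
  simplicial : ∀ {z} → z ∈ Z → IsSimplicial G z
  simplicial z∈Z = proj₁ (proj₁ (proj₂ (proj₂ (proj₂ cand))) _ z∈Z)
  uniform : ∀ {v X u w} → CompleteTo G v X ⊎ AnticompleteTo G v X → u ∈ X → w ∈ X → E G v u → E G v w
  uniform (inj₁ complete) _ w∈X _ = complete _ w∈X
  uniform (inj₂ anticomplete) u∈X _ vu = contradiction vu (anticomplete _ u∈X)
  -- A neighbour `y` of `z` in `Y` misses some `x` in `X`, and `x` is a neighbour of `z` as well.
  notSimplicial : ∀ {X Y z} → IsClique G X → (∀ {v} → v ∈ X → v ∉ Y) → MixedOn G z Y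
    → (∀ y → y ∈ Y → MixedOn G y X) → z ∈ X → ¬ IsSimplicial G z
  notSimplicial clique disj ((y , y∈Y , zy) , _) mixedY z∈X simp
    with _ , x , x∈X , ¬yx ← mixedY y y∈Y =
    ¬yx (simp y x zy (clique _ x z∈X x∈X λ { refl → ¬yx (E-sym G zy) }) λ { refl → disj x∈X y∈Y })
  notSimplicialA : ∀ {z} → z ∈ A → ¬ IsSimplicial G z
  notSimplicialA z∈A = notSimplicial A-clique (disjoint _) (mixedA _ z∈A) mixedB z∈A
  notSimplicialB : ∀ {z} → z ∈ B → ¬ IsSimplicial G z
  notSimplicialB z∈B = notSimplicial B-clique (λ v∈B v∈A → disjoint _ v∈A v∈B) (mixedB _ z∈B) mixedA z∈B
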